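{- Let $\mathcal{G}=(V,E)$ be an $m$-uniform connected hypergraph with $m>2$ and $n$ vertices. Then $$\lambda_n(L_{\mathcal{G}})\le\max_{i\in V}\frac{2d_i(m-1)-1+\sqrt{4(m-1)^2d_i m_i D_{\max}^2-2d_i(m-1)+1}}{2(m-1)},$$ where $m_i=\big(\sum_{j\sim i}d_j\big)/\big(d_i(m-1)\big)$ and $D_{\max}=\max\{d_{xy}: x,y\in V\}$.
   Context: A hypergraph $\mathcal{G}=(V,E)$ has a finite vertex set $V$ and a set $E$ of subsets of $V$ (edges); it is $m$-uniform if every edge has exactly $m$ vertices. Distinct vertices $i,j$ are adjacent ($i\sim j$) if some edge contains both. The degree $d_i$ is the number of edges containing $i$, and the codegree $d_{xy}$ of distinct vertices $x,y$ is the number of edges containing both. The Laplacian $L_{\mathcal{G}}$ has $(L_{\mathcal{G}})_{ii}=d_i$ and $(L_{\mathcal{G}})_{ij}=-d_{ij}/(m-1)$ for $i\ne j$; $\lambda_n(L_{\mathcal{G}})$ is its largest eigenvalue. -}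

module Defs where

open import Data.Fin.Base using (Fin; zero; suc)
import Data.Fin.Properties as Fin
open import Data.Fin.Subset as Subset using (Subset; _∈_)
open import Data.Fin.Subset.Properties using (_∈?_)
import Data.Integer.Base as ℤ
import Data.Integer.Properties as ℤₚ
open import Data.List.Base using (List; length; filter; map; allFin; cartesianProduct)
open import Data.List.Extrema.Nat using (max)
open import Data.List.Relation.Unary.All using (All)
open import Data.List.Relation.Unary.Any using (Any; any?)
open import Data.List.Relation.Unary.Unique.Propositional using (Unique)
open import Data.Nat.ListAction using (sum)
open import Data.Nat.Coprimality using (Coprime)
open import Data.Nat.Base as ℕ using (ℕ; zero; suc; _∸_; _^_)
import Data.Nat.Properties as ℕₚ
import Data.Nat.Tactic.RingSolver as ℕ-Ring
open import Data.Product.Base using (_×_; _,_; ∃; ∃-syntax)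
open import Data.Rational.Base as ℚ using (ℚ; mkℚ; 0ℚ; 1ℚ; ½)
import Data.Rational.Properties as ℚₚ
import Data.Rational.Unnormalised.Base as ℚᵘ
import Data.Rational.Unnormalised.Properties as ℚᵘₚ
open import Data.Rational.Solver using (module +-*-Solver)
open import Data.Sum.Base using (inj₁; inj₂)
open import Data.Vec.Functional using (Vector; foldr; head; tail)
open import Relation.Binary.Construct.Closure.ReflexiveTransitive using (Star)
open import Relation.Binary.PropositionalEquality using (_≡_; _≢_; refl; sym; trans; cong; cong₂; subst₂)
open import Relation.Nullary using (¬_; Dec; yes; no; ¬?; _×-dec_; contradiction)

module ℚ-Lemmas where
  open import Data.Rational.Base
  open import Data.Rational.Properties
  open +-*-Solver

  p≤∣p∣ : ∀ p → p ≤ ∣ p ∣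
  p≤∣p∣ p with ≤-total 0ℚ p
  ... | inj₁ 0≤p = ≤-reflexive (sym (0≤p⇒∣p∣≡p 0≤p))
  ... | inj₂ p≤0 = ≤-trans p≤0 (0≤∣p∣ p)

  ∣-∣≤⇒≤+ : ∀ p q {ε} → ∣ p - q ∣ ≤ ε → p ≤ q + ε
  ∣-∣≤⇒≤+ p q {ε} h = begin
    p            ≡⟨ solve 2 (λ p q → p := q :+ (p :- q)) refl p q ⟩
    q + (p - q)  ≤⟨ +-monoʳ-≤ q (≤-trans (p≤∣p∣ (p - q)) h) ⟩
    q + ε        ∎
    where open ≤-Reasoning

  ≤+⇒-≤ : ∀ {p q ε} → p ≤ q + ε → p - q ≤ ε
  ≤+⇒-≤ {p} {q} {ε} h = begin
    p - q        ≤⟨ +-monoˡ-≤ (- q) h ⟩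
    q + ε - q    ≡⟨ solve 2 (λ q ε → q :+ ε :- q := ε) refl q ε ⟩
    ε            ∎
    where open ≤-Reasoning

  ≤+⇒∣-∣≤ : ∀ {p q ε} → p ≤ q + ε → q ≤ p + ε → ∣ p - q ∣ ≤ ε
  ≤+⇒∣-∣≤ {p} {q} {ε} h k with ∣p∣≡p∨∣p∣≡-p (p - q)
  ... | inj₁ e = ≤-trans (≤-reflexive e) (≤+⇒-≤ h)
  ... | inj₂ e = ≤-trans (≤-reflexive (trans e (solve 2 (λ p q → :- (p :- q) := q :- p) refl p q))) (≤+⇒-≤ k)

  0<½* : ∀ {ε} → 0ℚ < ε → 0ℚ < ½ * ε
  0<½* {ε} h = positive⁻¹ (½ * ε) {{pos*pos⇒pos ½ ε {{positive h}}}}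

  ½+½ : ∀ ε → ½ * ε + ½ * ε ≡ ε
  ½+½ ε = trans (sym (*-distribʳ-+ ε ½ ½)) (*-identityˡ ε)

  0≤* : ∀ {p q} → 0ℚ ≤ p → 0ℚ ≤ q → 0ℚ ≤ p * q
  0≤* {p} {q} hp hq = nonNegative⁻¹ (p * q) {{nonNeg*nonNeg⇒nonNeg p {{nonNegative hp}} q {{nonNegative hq}}}}

  0<* : ∀ {p q} → 0ℚ < p → 0ℚ < q → 0ℚ < p * q
  0<* {p} {q} hp hq = positive⁻¹ (p * q) {{pos*pos⇒pos p {{positive hp}} q {{positive hq}}}}

  *-mono-≤₀ : ∀ {p q r s} → 0ℚ ≤ q → 0ℚ ≤ r → p ≤ q → r ≤ s → p * r ≤ q * s
  *-mono-≤₀ {p} {q} {r} {s} 0≤q 0≤r p≤q r≤s = ≤-trans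
    (*-monoʳ-≤-nonNeg r {{nonNegative 0≤r}} p≤q)
    (*-monoˡ-≤-nonNeg q {{nonNegative 0≤q}} r≤s)

  sq-cancel-≤ : ∀ {p q} → 0ℚ ≤ q → p * p ≤ q * q → p ≤ q
  sq-cancel-≤ {p} {q} 0≤q h with p ≤? q
  ... | yes p≤q = p≤q
  ... | no p≰q  = contradiction (<-≤-trans q²<p² h) (<-irrefl refl)
    where
    q<p = ≰⇒> p≰q
    q²<p² : q * q < p * p
    q²<p² = ≤-<-trans (*-monoˡ-≤-nonNeg q {{nonNegative 0≤q}} (<⇒≤ q<p))
                      (*-monoˡ-<-pos p {{positive (≤-<-trans 0≤q q<p)}} q<p)

  ⊔-lipschitz : ∀ p q r s {ε} → p ≤ r + ε → q ≤ s + ε → p ⊔ q ≤ (r ⊔ s) + ε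
  ⊔-lipschitz p q r s {ε} h k = ⊔-lub
    (≤-trans h (+-monoˡ-≤ ε (p≤p⊔q r s)))
    (≤-trans k (+-monoˡ-≤ ε (p≤q⊔p r s)))

  1/suc : ℕ → ℚ
  1/suc n = ℤ.+ 1 / suc n

  private
    toℚᵘ-/ : ∀ i n → toℚᵘ (i / suc n) ℚᵘ.≃ ℚᵘ.mkℚᵘ i n
    toℚᵘ-/ i n = toℚᵘ-fromℚᵘ (ℚᵘ.mkℚᵘ i n)

  0≤+/ : ∀ k n → 0ℚ ≤ ℤ.+ k / suc n
  0≤+/ k n = nonNegative⁻¹ (ℤ.+ k / suc n) {{normalize-nonNeg k (suc n)}}

  1/suc-archimedean : ∀ ε → 0ℚ < ε → ∃ λ N → ∀ n → N ℕ.≤ n → 1/suc n ≤ ε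
  1/suc-archimedean (mkℚ (ℤ.+ zero) d c) (*<* (ℤ.+<+ ()))
  1/suc-archimedean (mkℚ ℤ.-[1+ k ] d c) (*<* ())
  1/suc-archimedean ε@(mkℚ ℤ.+[1+ k ] d c) _ = d , λ n d≤n → toℚᵘ-cancel-≤
    (ℚᵘₚ.≤-respˡ-≃ (ℚᵘₚ.≃-sym (toℚᵘ-/ (ℤ.+ 1) n))
      (ℚᵘ.*≤* (ℤ.+≤+ (ℕₚ.*-mono-≤ {1} {suc k} (ℕ.s≤s ℕ.z≤n) (ℕ.s≤s d≤n)))))

  -- With b = d + 1, compares (s / (b (n+1)))² with p / b.
  module _ (p d n s : ℕ) .(c : Coprime p (suc d)) where
    private
      q = mkℚ (ℤ.+ p) d c
      w = n ℕ.+ d ℕ.* suc n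

      suc-w² : suc w ℕ.* suc w ≡ suc d ℕ.* (suc n ℕ.* suc n) ℕ.* suc d
      suc-w² = shuffle (suc d) (suc n)
        where
        shuffle : ∀ a b → (a ℕ.* b) ℕ.* (a ℕ.* b) ≡ a ℕ.* (b ℕ.* b) ℕ.* a
        shuffle = ℕ-Ring.solve-∀

      square : ∀ t → toℚᵘ ((ℤ.+ t / suc w) * (ℤ.+ t / suc w)) ℚᵘ.≃ ℚᵘ.mkℚᵘ (ℤ.+ t) w ℚᵘ.* ℚᵘ.mkℚᵘ (ℤ.+ t) w
      square t = ℚᵘₚ.≃-trans (toℚᵘ-homo-* (ℤ.+ t / suc w) (ℤ.+ t / suc w))
                             (ℚᵘₚ.*-cong (toℚᵘ-/ (ℤ.+ t) w) (toℚᵘ-/ (ℤ.+ t) w))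

      left : ∀ t → ℤ.+ (t ℕ.* t ℕ.* suc d) ≡ (ℤ.+ t ℤ.* ℤ.+ t) ℤ.* ℤ.+ suc d
      left t = trans (ℤₚ.pos-* (t ℕ.* t) (suc d)) (cong (ℤ._* ℤ.+ suc d) (ℤₚ.pos-* t t))

      right : ℤ.+ (p ℕ.* suc d ℕ.* (suc n ℕ.* suc n) ℕ.* suc d) ≡ ℤ.+ p ℤ.* ℤ.+ (suc w ℕ.* suc w)
      right = trans (cong ℤ.+_ (trans (assoc p (suc d) (suc n ℕ.* suc n) (suc d)) (cong (p ℕ.*_) (sym suc-w²))))
                    (ℤₚ.pos-* p (suc w ℕ.* suc w))
        where
        assoc : ∀ a b c e → a ℕ.* b ℕ.* c ℕ.* e ≡ a ℕ.* (b ℕ.* c ℕ.* e)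
        assoc = ℕ-Ring.solve-∀

    sq-≤ : s ℕ.* s ℕ.≤ p ℕ.* suc d ℕ.* (suc n ℕ.* suc n) →
           (ℤ.+ s / suc w) * (ℤ.+ s / suc w) ≤ q
    sq-≤ h = toℚᵘ-cancel-≤ (ℚᵘₚ.≤-respˡ-≃ (ℚᵘₚ.≃-sym (square s)) (ℚᵘ.*≤*
      (subst₂ ℤ._≤_ (left s) right (ℤ.+≤+ (ℕₚ.*-monoˡ-≤ (suc d) h)))))

    sq-> : p ℕ.* suc d ℕ.* (suc n ℕ.* suc n) ℕ.< s ℕ.* s →
           q < (ℤ.+ s / suc w) * (ℤ.+ s / suc w)
    sq-> h = toℚᵘ-cancel-< (ℚᵘₚ.<-respʳ-≃ (ℚᵘₚ.≃-sym (square s)) (ℚᵘ.*<*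
      (subst₂ ℤ._<_ right (left s) (ℤ.+<+ (ℕₚ.*-monoˡ-< (suc d) h)))))

  suc/≤ : ∀ s d n → ℤ.+ suc s / (suc d ℕ.* suc n) ≤ ℤ.+ s / (suc d ℕ.* suc n) + 1/suc n
  suc/≤ s d n = ≤-trans (≤-reflexive split) (+-monoʳ-≤ (ℤ.+ s / suc w) 1/≤)
    where
    w = n ℕ.+ d ℕ.* suc n

    1/≤ : 1/suc w ≤ 1/suc n
    1/≤ = toℚᵘ-cancel-≤ (ℚᵘₚ.≤-respˡ-≃ (ℚᵘₚ.≃-sym (toℚᵘ-/ (ℤ.+ 1) w)) (ℚᵘₚ.≤-respʳ-≃ (ℚᵘₚ.≃-sym (toℚᵘ-/ (ℤ.+ 1) n))
      (ℚᵘ.*≤* (ℤ.+≤+ (ℕₚ.*-monoʳ-≤ 1 (ℕ.s≤s (ℕₚ.m≤m+n n (d ℕ.* suc n))))))))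

    numerators : ℤ.+ (suc s ℕ.* (suc w ℕ.* suc w)) ≡
                 (ℤ.+ s ℤ.* ℤ.+ suc w ℤ.+ ℤ.+ 1 ℤ.* ℤ.+ suc w) ℤ.* ℤ.+ suc w
    numerators = trans (cong ℤ.+_ (distrib s (suc w)))
      (trans (ℤₚ.pos-* (s ℕ.* suc w ℕ.+ 1 ℕ.* suc w) (suc w))
        (cong (ℤ._* ℤ.+ suc w) (cong₂ ℤ._+_ (ℤₚ.pos-* s (suc w)) (ℤₚ.pos-* 1 (suc w)))))
      where
      distrib : ∀ a b → suc a ℕ.* (b ℕ.* b) ≡ (a ℕ.* b ℕ.+ 1 ℕ.* b) ℕ.* b
      distrib = ℕ-Ring.solve-∀

    split : ℤ.+ suc s / suc w ≡ ℤ.+ s / suc w + 1/suc w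
    split = toℚᵘ-injective (ℚᵘₚ.≃-trans (toℚᵘ-/ (ℤ.+ suc s) w) (ℚᵘₚ.≃-sym
      (ℚᵘₚ.≃-trans (toℚᵘ-homo-+ (ℤ.+ s / suc w) (1/suc w))
        (ℚᵘₚ.≃-trans (ℚᵘₚ.+-cong (toℚᵘ-/ (ℤ.+ s) w) (toℚᵘ-/ (ℤ.+ 1) w))
          (ℚᵘ.*≡* (trans (sym numerators) (ℤₚ.pos-* (suc s) (suc w ℕ.* suc w))))))))

open ℚ-Lemmas

-- ⌊√k⌋
isqrt : ℕ → ℕ
isqrt zero    = 0
isqrt (suc k) with suc (isqrt k) ℕ.* suc (isqrt k) ℕₚ.≤? suc k
... | yes _ = suc (isqrt k)
... | no  _ = isqrt k

isqrt-≤ : ∀ k → isqrt k ℕ.* isqrt k ℕ.≤ k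
isqrt-≤ zero    = ℕ.z≤n
isqrt-≤ (suc k) with suc (isqrt k) ℕ.* suc (isqrt k) ℕₚ.≤? suc k
... | yes h = h
... | no  _ = ℕₚ.m≤n⇒m≤1+n (isqrt-≤ k)

isqrt-> : ∀ k → k ℕ.< suc (isqrt k) ℕ.* suc (isqrt k)
isqrt-> zero    = ℕ.s≤s ℕ.z≤n
isqrt-> (suc k) with suc (isqrt k) ℕ.* suc (isqrt k) ℕₚ.≤? suc k
... | yes _ = ℕₚ.≤-<-trans (isqrt-> k) (ℕₚ.*-mono-< {r} {suc r} (ℕₚ.n<1+n r) (ℕₚ.n<1+n r))
  where r = suc (isqrt k)
... | no ¬h = ℕₚ.≰⇒> ¬h

-- √(p/b) to within 1/(n+1), as ⌊√(p b (n+1)²)⌋ / (b (n+1)); zero on negative rationals.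
sqrtApprox : ℕ → ℚ → ℚ
sqrtApprox n (mkℚ (ℤ.+ p) d _)    =
  ℤ.+ isqrt (p ℕ.* suc d ℕ.* (suc n ℕ.* suc n)) ℚ./ (suc d ℕ.* suc n)
sqrtApprox n (mkℚ ℤ.-[1+ _ ] _ _) = 0ℚ

sqrtApprox-nonNeg : ∀ n q → 0ℚ ℚ.≤ sqrtApprox n q
sqrtApprox-nonNeg n (mkℚ (ℤ.+ p) d _)    = 0≤+/ (isqrt (p ℕ.* suc d ℕ.* (suc n ℕ.* suc n))) (n ℕ.+ d ℕ.* suc n)
sqrtApprox-nonNeg n (mkℚ ℤ.-[1+ _ ] _ _) = ℚₚ.≤-refl

sqrtApprox-≤ : ∀ n q → sqrtApprox n q ℚ.* sqrtApprox n q ℚ.≤ q ℚ.⊔ 0ℚ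
sqrtApprox-≤ n q@(mkℚ (ℤ.+ p) d c) = ℚₚ.≤-trans
  (sq-≤ p d n (isqrt k) c (isqrt-≤ k)) (ℚₚ.p≤p⊔q q 0ℚ)
  where k = p ℕ.* suc d ℕ.* (suc n ℕ.* suc n)
sqrtApprox-≤ n q@(mkℚ ℤ.-[1+ _ ] _ _) = ℚₚ.p≤q⊔p q 0ℚ

sqrtApprox-≥ : ∀ n q → q ℚ.≤ (sqrtApprox n q ℚ.+ 1/suc n) ℚ.* (sqrtApprox n q ℚ.+ 1/suc n)
sqrtApprox-≥ n q@(mkℚ (ℤ.+ p) d c) = ℚₚ.≤-trans
  (ℚₚ.<⇒≤ (sq-> p d n (suc (isqrt k)) c (isqrt-> k)))
  (*-mono-≤₀ (ℚₚ.≤-trans 0≤u u≤) 0≤u u≤ u≤)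
  where
  k = p ℕ.* suc d ℕ.* (suc n ℕ.* suc n)
  u≤ = suc/≤ (isqrt k) d n
  0≤u = 0≤+/ (suc (isqrt k)) (n ℕ.+ d ℕ.* suc n)
sqrtApprox-≥ n q@(mkℚ ℤ.-[1+ _ ] _ _) = ℚₚ.≤-trans (ℚₚ.nonPositive⁻¹ q) (0≤* 0≤r 0≤r)
  where 0≤r = ℚₚ.+-mono-≤ {0ℚ} ℚₚ.≤-refl (0≤+/ 1 n)

-- Real numbers as Cauchy sequences of rationals, taken up to _≃_.
record ℝ : Set where
  constructor mkℝ
  field
    seq    : ℕ → ℚ
    cauchy : ∀ ε → 0ℚ ℚ.< ε →
             ∃[ N ] ∀ m n → N ℕ.≤ m → N ℕ.≤ n → ℚ.∣ seq m ℚ.- seq n ∣ ℚ.≤ ε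

open ℝ public

infix  4 _≃_ _≤_
infixl 6 _+_ _⊔_
infixl 7 _*_

_≃_ : ℝ → ℝ → Set
x ≃ y = ∀ ε → 0ℚ ℚ.< ε → ∃[ N ] ∀ n → N ℕ.≤ n → ℚ.∣ seq x n ℚ.- seq y n ∣ ℚ.≤ ε

_≤_ : ℝ → ℝ → Set
x ≤ y = ∀ ε → 0ℚ ℚ.< ε → ∃[ N ] ∀ n → N ℕ.≤ n → seq x n ℚ.≤ seq y n ℚ.+ ε

fromℚ : ℚ → ℝ
fromℚ q = mkℝ (λ _ → q) λ ε 0<ε → 0 , λ _ _ _ _ →
  ℚₚ.≤-trans (ℚₚ.≤-reflexive (cong ℚ.∣_∣ (ℚₚ.+-inverseʳ q))) (ℚₚ.<⇒≤ 0<ε)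

0ℝ : ℝ
0ℝ = fromℚ 0ℚ

private
  open +-*-Solver

  ≤⊔ˡ : ∀ {M N n} → M ℕ.⊔ N ℕ.≤ n → M ℕ.≤ n
  ≤⊔ˡ {M} {N} = ℕₚ.m⊔n≤o⇒m≤o M N

  ≤⊔ʳ : ∀ {M N n} → M ℕ.⊔ N ℕ.≤ n → N ℕ.≤ n
  ≤⊔ʳ {M} {N} = ℕₚ.m⊔n≤o⇒n≤o M N

_+_ : ℝ → ℝ → ℝ
x + y = mkℝ (λ n → seq x n ℚ.+ seq y n) λ ε 0<ε →
  let M , hM = cauchy x (½ ℚ.* ε) (0<½* 0<ε)
      N , hN = cauchy y (½ ℚ.* ε) (0<½* 0<ε)
  in M ℕ.⊔ N , λ m n M⊔N≤m M⊔N≤n → begin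
    ℚ.∣ (seq x m ℚ.+ seq y m) ℚ.- (seq x n ℚ.+ seq y n) ∣
      ≡⟨ cong ℚ.∣_∣ (solve 4 (λ a b c d → (a :+ b) :- (c :+ d) := (a :- c) :+ (b :- d)) refl
           (seq x m) (seq y m) (seq x n) (seq y n)) ⟩
    ℚ.∣ (seq x m ℚ.- seq x n) ℚ.+ (seq y m ℚ.- seq y n) ∣
      ≤⟨ ℚₚ.∣p+q∣≤∣p∣+∣q∣ (seq x m ℚ.- seq x n) (seq y m ℚ.- seq y n) ⟩
    ℚ.∣ seq x m ℚ.- seq x n ∣ ℚ.+ ℚ.∣ seq y m ℚ.- seq y n ∣
      ≤⟨ ℚₚ.+-mono-≤ (hM m n (≤⊔ˡ M⊔N≤m) (≤⊔ˡ M⊔N≤n)) (hN m n (≤⊔ʳ {M} M⊔N≤m) (≤⊔ʳ {M} M⊔N≤n)) ⟩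
    ½ ℚ.* ε ℚ.+ ½ ℚ.* ε
      ≡⟨ ½+½ ε ⟩
    ε ∎
  where open ℚₚ.≤-Reasoning

eventuallyBounded : ∀ x → ∃[ B ] (0ℚ ℚ.< B) × ∃[ N ] (∀ n → N ℕ.≤ n → ℚ.∣ seq x n ∣ ℚ.≤ B)
eventuallyBounded x =
  let N , hN = cauchy x 1ℚ (ℚₚ.positive⁻¹ 1ℚ)
  in ℚ.∣ seq x N ∣ ℚ.+ 1ℚ
   , ℚₚ.+-mono-≤-< (ℚₚ.0≤∣p∣ (seq x N)) (ℚₚ.positive⁻¹ 1ℚ)
   , N , λ n N≤n → begin
       ℚ.∣ seq x n ∣
         ≡⟨ cong ℚ.∣_∣ (solve 2 (λ a b → a := b :+ (a :- b)) refl (seq x n) (seq x N)) ⟩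
       ℚ.∣ seq x N ℚ.+ (seq x n ℚ.- seq x N) ∣
         ≤⟨ ℚₚ.∣p+q∣≤∣p∣+∣q∣ (seq x N) (seq x n ℚ.- seq x N) ⟩
       ℚ.∣ seq x N ∣ ℚ.+ ℚ.∣ seq x n ℚ.- seq x N ∣
         ≤⟨ ℚₚ.+-monoʳ-≤ ℚ.∣ seq x N ∣ (hN n N N≤n ℕₚ.≤-refl) ⟩
       ℚ.∣ seq x N ∣ ℚ.+ 1ℚ ∎
  where open ℚₚ.≤-Reasoning

private
  scale : ∀ B ε → 0ℚ ℚ.< B → 0ℚ ℚ.< ε → ∃[ η ] (0ℚ ℚ.< η) × B ℚ.* η ≡ ε
  scale B ε 0<B 0<ε = B⁻¹ ℚ.* ε
    , 0<* (ℚₚ.positive⁻¹ B⁻¹ {{ℚₚ.1/pos⇒pos B {{ℚ.positive 0<B}}}}) 0<ε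
    , trans (sym (ℚₚ.*-assoc B B⁻¹ ε)) (trans (cong (ℚ._* ε) (ℚₚ.*-inverseʳ B {{B≢0}})) (ℚₚ.*-identityˡ ε))
    where
    B≢0 = ℚₚ.pos⇒nonZero B {{ℚ.positive 0<B}}
    B⁻¹ = (ℚ.1/ B) {{B≢0}}

_*_ : ℝ → ℝ → ℝ
x * y = mkℝ (λ n → seq x n ℚ.* seq y n) λ ε 0<ε →
  let B , 0<B , K , hK = eventuallyBounded x
      C , 0<C , L , hL = eventuallyBounded y
      η , 0<η , Bη≡ = scale B (½ ℚ.* ε) 0<B (0<½* 0<ε)
      θ , 0<θ , Cθ≡ = scale C (½ ℚ.* ε) 0<C (0<½* 0<ε)
      M , hM = cauchy y η 0<η
      N , hN = cauchy x θ 0<θ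
  in (K ℕ.⊔ L) ℕ.⊔ (M ℕ.⊔ N) , λ m n hm hn → begin
    ℚ.∣ seq x m ℚ.* seq y m ℚ.- seq x n ℚ.* seq y n ∣
      ≡⟨ cong ℚ.∣_∣ (solve 4 (λ a b c d → a :* b :- c :* d := a :* (b :- d) :+ d :* (a :- c)) refl
           (seq x m) (seq y m) (seq x n) (seq y n)) ⟩
    ℚ.∣ seq x m ℚ.* (seq y m ℚ.- seq y n) ℚ.+ seq y n ℚ.* (seq x m ℚ.- seq x n) ∣
      ≤⟨ ℚₚ.∣p+q∣≤∣p∣+∣q∣ (seq x m ℚ.* (seq y m ℚ.- seq y n)) (seq y n ℚ.* (seq x m ℚ.- seq x n)) ⟩
    ℚ.∣ seq x m ℚ.* (seq y m ℚ.- seq y n) ∣ ℚ.+ ℚ.∣ seq y n ℚ.* (seq x m ℚ.- seq x n) ∣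
      ≡⟨ cong₂ ℚ._+_ (ℚₚ.∣p*q∣≡∣p∣*∣q∣ (seq x m) (seq y m ℚ.- seq y n))
                     (ℚₚ.∣p*q∣≡∣p∣*∣q∣ (seq y n) (seq x m ℚ.- seq x n)) ⟩
    ℚ.∣ seq x m ∣ ℚ.* ℚ.∣ seq y m ℚ.- seq y n ∣ ℚ.+ ℚ.∣ seq y n ∣ ℚ.* ℚ.∣ seq x m ℚ.- seq x n ∣
      ≤⟨ ℚₚ.+-mono-≤
           (*-mono-≤₀ (ℚₚ.<⇒≤ 0<B) (ℚₚ.0≤∣p∣ (seq y m ℚ.- seq y n))
             (hK m (≤⊔ˡ {K} (≤⊔ˡ {K ℕ.⊔ L} hm)))
             (hM m n (≤⊔ˡ {M} (≤⊔ʳ {K ℕ.⊔ L} hm)) (≤⊔ˡ {M} (≤⊔ʳ {K ℕ.⊔ L} hn))))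
           (*-mono-≤₀ (ℚₚ.<⇒≤ 0<C) (ℚₚ.0≤∣p∣ (seq x m ℚ.- seq x n))
             (hL n (≤⊔ʳ {K} (≤⊔ˡ {K ℕ.⊔ L} hn)))
             (hN m n (≤⊔ʳ {M} (≤⊔ʳ {K ℕ.⊔ L} hm)) (≤⊔ʳ {M} (≤⊔ʳ {K ℕ.⊔ L} hn)))) ⟩
    B ℚ.* η ℚ.+ C ℚ.* θ
      ≡⟨ cong₂ ℚ._+_ Bη≡ Cθ≡ ⟩
    ½ ℚ.* ε ℚ.+ ½ ℚ.* ε
      ≡⟨ ½+½ ε ⟩
    ε ∎
  where open ℚₚ.≤-Reasoning

private
  oneSided : (s : ℕ → ℚ) →
             (∀ ε → 0ℚ ℚ.< ε → ∃[ N ] ∀ m n → N ℕ.≤ m → N ℕ.≤ n → s m ℚ.≤ s n ℚ.+ ε) →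
             ∀ ε → 0ℚ ℚ.< ε → ∃[ N ] ∀ m n → N ℕ.≤ m → N ℕ.≤ n → ℚ.∣ s m ℚ.- s n ∣ ℚ.≤ ε
  oneSided s h ε 0<ε =
    let N , hN = h ε 0<ε
    in N , λ m n N≤m N≤n → ≤+⇒∣-∣≤ (hN m n N≤m N≤n) (hN n m N≤n N≤m)

_⊔_ : ℝ → ℝ → ℝ
x ⊔ y = mkℝ s (oneSided s λ ε 0<ε →
  let M , hM = cauchy x ε 0<ε
      N , hN = cauchy y ε 0<ε
  in M ℕ.⊔ N , λ m n hm hn → ⊔-lipschitz (seq x m) (seq y m) (seq x n) (seq y n)
       (∣-∣≤⇒≤+ (seq x m) (seq x n) (hM m n (≤⊔ˡ hm) (≤⊔ˡ hn)))
       (∣-∣≤⇒≤+ (seq y m) (seq y n) (hN m n (≤⊔ʳ {M} hm) (≤⊔ʳ {M} hn))))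
  where
  s : ℕ → ℚ
  s n = seq x n ℚ.⊔ seq y n

-- The nonnegative square root on [0, ∞), extended by zero to negative reals.
√ : ℝ → ℝ
√ x = mkℝ s (oneSided s λ ε 0<ε →
  let η   = ½ ℚ.* ε
      0<η = 0<½* 0<ε
      M , hM = cauchy x (η ℚ.* η) (0<* 0<η 0<η)
      N , hN = 1/suc-archimedean η 0<η
  in M ℕ.⊔ N , λ m n hm hn →
       s-≤ m n η (ℚₚ.<⇒≤ 0<η) (∣-∣≤⇒≤+ (seq x m) (seq x n) (hM m n (≤⊔ˡ hm) (≤⊔ˡ hn))) (hN n (≤⊔ʳ {M} hn)) (½+½ ε))
  where
  s : ℕ → ℚ
  s n = sqrtApprox n (seq x n)

  s-≤ : ∀ m n η {ε} → 0ℚ ℚ.≤ η → seq x m ℚ.≤ seq x n ℚ.+ η ℚ.* η → 1/suc n ℚ.≤ η →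
        η ℚ.+ η ≡ ε → s m ℚ.≤ s n ℚ.+ ε
  s-≤ m n η {ε} 0≤η hx hδ refl = sq-cancel-≤ 0≤t (ℚₚ.≤-trans (sqrtApprox-≤ m (seq x m)) (ℚₚ.⊔-lub x≤t² (0≤* 0≤t 0≤t)))
    where
    open ℚₚ.≤-Reasoning
    u = s n ℚ.+ 1/suc n
    v = s n ℚ.+ η
    t = s n ℚ.+ (η ℚ.+ η)
    0≤s : 0ℚ ℚ.≤ s n
    0≤s = sqrtApprox-nonNeg n (seq x n)
    0≤u : 0ℚ ℚ.≤ u
    0≤u = ℚₚ.+-mono-≤ 0≤s (0≤+/ 1 n)
    0≤v : 0ℚ ℚ.≤ v
    0≤v = ℚₚ.+-mono-≤ 0≤s 0≤η
    0≤t : 0ℚ ℚ.≤ t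
    0≤t = ℚₚ.+-mono-≤ 0≤s (ℚₚ.+-mono-≤ 0≤η 0≤η)
    u≤v : u ℚ.≤ v
    u≤v = ℚₚ.+-monoʳ-≤ (s n) hδ
    x≤t² : seq x m ℚ.≤ t ℚ.* t
    x≤t² = begin
      seq x m                             ≤⟨ hx ⟩
      seq x n ℚ.+ η ℚ.* η                 ≤⟨ ℚₚ.+-monoˡ-≤ (η ℚ.* η) (ℚₚ.≤-trans (sqrtApprox-≥ n (seq x n)) (*-mono-≤₀ 0≤v 0≤u u≤v u≤v)) ⟩
      v ℚ.* v ℚ.+ η ℚ.* η                 ≡⟨ sym (ℚₚ.+-identityʳ _) ⟩
      v ℚ.* v ℚ.+ η ℚ.* η ℚ.+ 0ℚ          ≤⟨ ℚₚ.+-monoʳ-≤ (v ℚ.* v ℚ.+ η ℚ.* η) (ℚₚ.+-mono-≤ (0≤* 0≤v 0≤η) (0≤* 0≤v 0≤η)) ⟩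
      v ℚ.* v ℚ.+ η ℚ.* η ℚ.+ (v ℚ.* η ℚ.+ v ℚ.* η)
        ≡⟨ solve 2 (λ s η → (s :+ η) :* (s :+ η) :+ η :* η :+ ((s :+ η) :* η :+ (s :+ η) :* η)
                         := (s :+ (η :+ η)) :* (s :+ (η :+ η))) refl (s n) η ⟩
      t ℚ.* t ∎

maximum : ∀ {n} .{{_ : ℕ.NonZero n}} → Vector ℝ n → ℝ
maximum {suc n} f = foldr _⊔_ (head f) (tail f)

∑ : ∀ {n} → Vector ℝ n → ℝ
∑ = foldr _+_ 0ℝ

Matrix : ℕ → Set
Matrix n = Fin n → Fin n → ℝ

IsEigenvalue : ∀ {n} → Matrix n → ℝ → Set
IsEigenvalue {n} A μ = ∃ λ (v : Vector ℝ n) →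
  (¬ (∀ i → v i ≃ 0ℝ)) × (∀ i → ∑ (λ j → A i j * v j) ≃ μ * v i)

IsLargestEigenvalue : ∀ {n} → Matrix n → ℝ → Set
IsLargestEigenvalue A μ = IsEigenvalue A μ × (∀ ν → IsEigenvalue A ν → ν ≤ μ)

record Hypergraph (n : ℕ) : Set where
  field
    edges  : List (Subset n)
    unique : Unique edges

-- a / b, with the convention a / 0 = 0.
ratio : ℕ → ℕ → ℚ
ratio a zero    = 0ℚ
ratio a (suc b) = ℤ.+ a ℚ./ suc b

fromℕ : ℕ → ℚ
fromℕ a = ℤ.+ a ℚ./ 1

module _ {n : ℕ} (G : Hypergraph n) where
  open Hypergraph G

  Uniform : ℕ → Set
  Uniform m = All (λ e → Subset.∣ e ∣ ≡ m) edges

  Adjacent : Fin n → Fin n → Set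
  Adjacent i j = i ≢ j × Any (λ e → i ∈ e × j ∈ e) edges

  adjacent? : ∀ i j → Dec (Adjacent i j)
  adjacent? i j = ¬? (i Fin.≟ j) ×-dec any? (λ e → (i ∈? e) ×-dec (j ∈? e)) edges

  Connected : Set
  Connected = ∀ i j → Star Adjacent i j

  degree : Fin n → ℕ
  degree i = length (filter (λ e → i ∈? e) edges)

  codegree : Fin n → Fin n → ℕ
  codegree x y = length (filter (λ e → (x ∈? e) ×-dec (y ∈? e)) edges)

  -- The codegree is a notion for distinct vertices, so pairs (x , x) are left out;
  -- the value is 0 when there is only one vertex.
  maxCodegree : ℕ
  maxCodegree = max 0 (map (λ (x , y) → codegree x y)
    (filter (λ (x , y) → ¬? (x Fin.≟ y)) (cartesianProduct (allFin n) (allFin n))))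

  module _ (m : ℕ) where

    laplacian : Matrix n
    laplacian i j with i Fin.≟ j
    ... | yes _ = fromℚ (fromℕ (degree i))
    ... | no  _ = fromℚ (ℚ.- ratio (codegree i j) (m ∸ 1))

    -- m_i = (∑_{j ∼ i} d_j) / (d_i (m - 1)). In a connected hypergraph d_i = 0 only if
    -- i is the sole vertex, in which case this is 0 by the convention of ratio.
    averageDegree : Fin n → ℚ
    averageDegree i = ratio (sum (map degree (filter (adjacent? i) (allFin n))))
                            (degree i ℕ.* (m ∸ 1))

    radicand : Fin n → ℚ
    radicand i =
      fromℕ (4 ℕ.* (m ∸ 1) ^ 2 ℕ.* degree i) ℚ.* averageDegree i ℚ.* fromℕ (maxCodegree ^ 2)
        ℚ.- fromℕ (2 ℕ.* degree i ℕ.* (m ∸ 1)) ℚ.+ 1ℚ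

    degreeBound : Fin n → ℝ
    degreeBound i =
      (fromℚ (fromℕ (2 ℕ.* degree i ℕ.* (m ∸ 1)) ℚ.- 1ℚ) + √ (fromℚ (radicand i)))
        * fromℚ (ratio 1 (2 ℕ.* (m ∸ 1)))

{-# OPTIONS --safe #-}
-- Put k = m - 1, let A be the matrix of codegrees with zero diagonal, and let v be an
-- eigenvector for λ, so that A v = k (d - λ) v entrywise. For a symmetric B the energy
-- ½ ∑ B j l (v j - v l)² equals ∑ (row sum of B at j) (v j)² - vᵀ B v and is monotone in B.
-- As m ≥ 3, every edge through j and l contains a third vertex, hence A ≤ A² off the
-- diagonal; comparing the energies of A and A², and bounding the row sums of A² by
-- k D² ∑_{j ∼ i} d_j, gives
--   ∑ᵢ (k (d_i - λ)² + λ - D² ∑_{j ∼ i} d_j) (v i)² ≤ 0.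
-- If λ exceeded every bound by δ, each coefficient would be at least k δ² / 4, forcing v = 0.
-- All estimates are made on the rational approximations at one index, where the eigenvalue
-- equation holds up to a residual that tends to zero.
module Submission where

open import Defs hiding (_≤_; _+_; _*_; _⊔_; ∑)
open import Algebra.Bundles using (CommutativeRing)
open import Data.Bool.Base using (if_then_else_; true; false)
open import Data.Empty using (⊥; ⊥-elim)
open import Data.Fin.Base using (Fin; zero; suc)
import Data.Fin.Properties as Fin
open import Data.Fin.Subset as Subset using (Subset; inside; outside)
open import Data.Fin.Subset.Properties using (_∈?_)
import Data.Integer.Base as ℤ
import Data.Integer.Properties as ℤₚ
open import Data.List.Base using (List; []; _∷_; length; filter; map; allFin; tabulate)
import Data.List.Properties as List
open import Data.List.Extrema.Nat using (xs≤max)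
open import Data.List.Membership.Propositional.Properties using (∈-map⁺; ∈-filter⁺; ∈-cartesianProduct⁺; ∈-allFin)
open import Data.List.Relation.Unary.All as All using (All; []; _∷_)
open import Data.List.Relation.Unary.All.Properties using (¬Any⇒All¬)
open import Data.List.Relation.Unary.Any as Any using ()
open import Data.Nat.Base as ℕ using (ℕ; zero; suc; z≤n; s≤s; _<_; _^_; NonZero)
import Data.Nat.ListAction as ListAction
import Data.Nat.Properties as ℕₚ
import Data.Nat.Tactic.RingSolver as ℕ-Ring
open import Data.Product.Base using (_×_; _,_; proj₁; proj₂; ∃-syntax)
open import Data.Rational.Base as ℚ using (ℚ; 0ℚ; 1ℚ; ½)
import Data.Rational.Properties as ℚₚ
open import Data.Rational.Solver using (module +-*-Solver)
import Data.Rational.Unnormalised.Base as ℚᵘ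
import Data.Rational.Unnormalised.Properties as ℚᵘₚ
open import Data.Sum.Base using (_⊎_; inj₁; inj₂)
open import Data.Vec.Base using ([]; _∷_)
open import Data.Vec.Functional using (foldr)
open import Function.Base using (_∘_)
open import Relation.Binary.PropositionalEquality
open import Relation.Nullary using (Dec; does; yes; no; ¬?; _×-dec_; contradiction)
open import Relation.Unary using (Decidable)

open ℚ-Lemmas
open +-*-Solver

-- Finite sums and indicators over the natural numbers.

module Combinatorics where
  open import Data.Nat.Base
  open import Data.Nat.Properties
  open import Algebra.Properties.Semiring.Sum +-*-semiring public
    using (sum; sum-cong-≗; ∑-distrib-+; *-distribˡ-sum; sum-replicate-zero)

  private variable
    n : ℕ
    X : Set

  sum-mono : {f g : Fin n → ℕ} → (∀ i → f i ≤ g i) → sum f ≤ sum g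
  sum-mono {zero}  f≤g = z≤n
  sum-mono {suc n} f≤g = +-mono-≤ (f≤g zero) (sum-mono (f≤g ∘ suc))

  𝟙 : ∀ {p} {P : Set p} → Dec P → ℕ
  𝟙 P? = if does P? then 1 else 0

  𝟙-× : {P Q : Set} (P? : Dec P) (Q? : Dec Q) → 𝟙 (P? ×-dec Q?) ≡ 𝟙 P? * 𝟙 Q?
  𝟙-× (yes _) (yes _) = refl
  𝟙-× (yes _) (no  _) = refl
  𝟙-× (no  _) _       = refl

  𝟙-idem : {P : Set} (P? : Dec P) → 𝟙 P? * 𝟙 P? ≡ 𝟙 P?
  𝟙-idem (yes _) = refl
  𝟙-idem (no  _) = refl

  ∑ₗ : List X → (X → ℕ) → ℕ
  ∑ₗ xs f = ListAction.sum (map f xs)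

  ∑ₗ-cong : ∀ xs {f g : X → ℕ} → (∀ x → f x ≡ g x) → ∑ₗ xs f ≡ ∑ₗ xs g
  ∑ₗ-cong xs f≡g = cong ListAction.sum (List.map-cong f≡g xs)

  ∑ₗ-cong-All : ∀ {xs} {P : X → Set} {f g : X → ℕ} → (∀ {x} → P x → f x ≡ g x) → All P xs → ∑ₗ xs f ≡ ∑ₗ xs g
  ∑ₗ-cong-All f≡g []         = refl
  ∑ₗ-cong-All f≡g (px ∷ pxs) = cong₂ _+_ (f≡g px) (∑ₗ-cong-All f≡g pxs)

  ∑ₗ-mono-All : ∀ {xs} {P : X → Set} {f g : X → ℕ} → (∀ {x} → P x → f x ≤ g x) → All P xs → ∑ₗ xs f ≤ ∑ₗ xs g
  ∑ₗ-mono-All f≤g []         = z≤n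
  ∑ₗ-mono-All f≤g (px ∷ pxs) = +-mono-≤ (f≤g px) (∑ₗ-mono-All f≤g pxs)

  *-distribˡ-∑ₗ : ∀ c xs (f : X → ℕ) → c * ∑ₗ xs f ≡ ∑ₗ xs (λ x → c * f x)
  *-distribˡ-∑ₗ c []       f = *-zeroʳ c
  *-distribˡ-∑ₗ c (x ∷ xs) f = trans (*-distribˡ-+ c (f x) (∑ₗ xs f)) (cong (c * f x +_) (*-distribˡ-∑ₗ c xs f))

  sum-∑ₗ-comm : ∀ xs (f : Fin n → X → ℕ) → sum (λ i → ∑ₗ xs (f i)) ≡ ∑ₗ xs (λ x → sum (λ i → f i x))
  sum-∑ₗ-comm {n} []   f = sum-replicate-zero n
  sum-∑ₗ-comm (x ∷ xs) f = trans (∑-distrib-+ (λ i → f i x) (λ i → ∑ₗ xs (f i)))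
                                 (cong (sum (λ i → f i x) +_) (sum-∑ₗ-comm xs f))

  -- Expanding the product gives the termwise products plus nonnegative cross terms. For codegrees,
  -- the termwise products come from two-step paths inside one edge.
  ∑ₗ-*-≤ : ∀ xs (f g : X → ℕ) → ∑ₗ xs (λ x → f x * g x) ≤ ∑ₗ xs f * ∑ₗ xs g
  ∑ₗ-*-≤ []       f g = z≤n
  ∑ₗ-*-≤ (x ∷ xs) f g = begin
    a * b + ∑ₗ xs (λ x → f x * g x)    ≤⟨ +-monoʳ-≤ (a * b) (∑ₗ-*-≤ xs f g) ⟩
    a * b + F * H                      ≤⟨ m≤m+n (a * b + F * H) (a * H + F * b) ⟩
    a * b + F * H + (a * H + F * b)    ≡⟨ expand a b F H ⟩
    (a + F) * (b + H)                  ∎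
    where
    open ≤-Reasoning
    a = f x
    b = g x
    F = ∑ₗ xs f
    H = ∑ₗ xs g
    expand : ∀ a b F H → a * b + F * H + (a * H + F * b) ≡ (a + F) * (b + H)
    expand = ℕ-Ring.solve-∀

  length-filter : ∀ {P : X → Set} (P? : Decidable P) xs → length (filter P? xs) ≡ ∑ₗ xs (𝟙 ∘ P?)
  length-filter P? []       = refl
  length-filter P? (x ∷ xs) with P? x
  ... | yes _ = cong suc (length-filter P? xs)
  ... | no  _ = length-filter P? xs

  ∑ₗ-filter : ∀ {P : X → Set} (P? : Decidable P) xs f → ∑ₗ (filter P? xs) f ≡ ∑ₗ xs (λ x → 𝟙 (P? x) * f x)
  ∑ₗ-filter P? []       f = refl
  ∑ₗ-filter P? (x ∷ xs) f with P? x
  ... | yes _ = cong₂ _+_ (sym (*-identityˡ (f x))) (∑ₗ-filter P? xs f)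
  ... | no  _ = ∑ₗ-filter P? xs f

  ∑ₗ-tabulate : ∀ (g : Fin n → X) f → ∑ₗ (tabulate g) f ≡ sum (f ∘ g)
  ∑ₗ-tabulate {zero}  g f = refl
  ∑ₗ-tabulate {suc n} g f = cong (f (g zero) +_) (∑ₗ-tabulate (g ∘ suc) f)

  ≢⇒𝟙 : {i j : Fin n} → i ≢ j → 𝟙 (¬? (i Fin.≟ j)) ≡ 1
  ≢⇒𝟙 {i = i} {j} i≢j with i Fin.≟ j
  ... | yes i≡j = contradiction i≡j i≢j
  ... | no  _   = refl

  𝟙≢-sym : (i j : Fin n) → 𝟙 (¬? (i Fin.≟ j)) ≡ 𝟙 (¬? (j Fin.≟ i))
  𝟙≢-sym i j with i Fin.≟ j | j Fin.≟ i
  ... | yes _   | yes _   = refl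
  ... | yes i≡j | no j≢i  = contradiction (sym i≡j) j≢i
  ... | no i≢j  | yes j≡i = contradiction (sym j≡i) i≢j
  ... | no _    | no _    = refl

  -- The term at `i` is added back rather than subtracted, since subtraction on `ℕ` truncates.
  sum-≢ : (i : Fin n) (f : Fin n → ℕ) → sum (λ j → 𝟙 (¬? (i Fin.≟ j)) * f j) + f i ≡ sum f
  sum-≢ zero    f = trans (+-comm (sum (λ j → 1 * f (suc j))) (f zero))
    (cong (f zero +_) (sum-cong-≗ (λ j → *-identityˡ (f (suc j)))))
  sum-≢ (suc i) f = trans (+-assoc (1 * f zero) _ (f (suc i)))
    (cong₂ _+_ (*-identityˡ (f zero)) (sum-≢ i (f ∘ suc)))

  -- Counting inside a single edge.

  ∣∣≡sum : (e : Subset n) → Subset.∣ e ∣ ≡ sum (λ i → 𝟙 (i ∈? e))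
  ∣∣≡sum []            = refl
  ∣∣≡sum (inside  ∷ e) = cong suc (∣∣≡sum e)
  ∣∣≡sum (outside ∷ e) = ∣∣≡sum e

  χ : Subset n → Fin n → ℕ
  χ e i = 𝟙 (i ∈? e)

  -- The adjacency matrix of the complete graph on `e`; summed over all edges these give the
  -- codegrees off the diagonal.
  χχ≢ : Subset n → Fin n → Fin n → ℕ
  χχ≢ e i j = 𝟙 (¬? (i Fin.≟ j)) * (χ e i * χ e j)

  -- An edge with `suc k` vertices offers `k` partners to each of them; for `i` outside `e` both
  -- sides vanish.
  sum-χχ≢ : ∀ {k} {e : Subset n} i → Subset.∣ e ∣ ≡ suc k → sum (χχ≢ e i) ≡ k * χ e i
  sum-χχ≢ {n} {k} {e} i ∣e∣≡ with i ∈? e | sum-≢ i (χ e)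
  ... | no _  | _ = trans (sum-cong-≗ (λ j → *-zeroʳ (𝟙 (¬? (i Fin.≟ j)))))
                          (trans (sum-replicate-zero n) (sym (*-zeroʳ k)))
  ... | yes _ | h = trans (sum-cong-≗ (λ j → cong (𝟙 (¬? (i Fin.≟ j)) *_) (*-identityˡ (χ e j))))
                          (trans (suc-injective (trans (+-comm 1 _) (trans h (trans (sym (∣∣≡sum e)) ∣e∣≡)))) (sym (*-identityʳ k)))

  -- Deleting `j` and `l` from `e` leaves at least one vertex `i`, which yields the path from `j`
  -- through `i` to `l` inside the edge.
  χχ≢-path : ∀ {e : Subset n} j l → 3 ≤ Subset.∣ e ∣ → χχ≢ e j l ≤ sum (λ i → χχ≢ e i j * χχ≢ e i l)
  χχ≢-path {e = e} j l 3≤∣e∣ with j Fin.≟ l | j ∈? e in eqj | l ∈? e in eql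
  ... | yes _  | _     | _     = z≤n
  ... | no _   | no _  | _     = z≤n
  ... | no _   | yes _ | no _  = z≤n
  -- The `2` restores the vertices `l` and `j`, which `sum-≢` removes in turn; the goal becomes a
  -- comparison with the size of `e`.
  ... | no j≢l | yes _ | yes _ = +-cancelʳ-≤ 2 1 _ (begin
    3                                             ≤⟨ 3≤∣e∣ ⟩
    Subset.∣ e ∣                                  ≡⟨ ∣∣≡sum e ⟩
    sum (χ e)                                     ≡⟨ sum-≢ l (χ e) ⟨
    sum f + χ e l                                 ≡⟨ cong (_+ χ e l) (sum-≢ j f) ⟨
    sum (λ i → 𝟙 (¬? (j Fin.≟ i)) * f i) + f j + χ e l  ≡⟨ cong₂ _+_ (cong₂ _+_ (sum-cong-≗ term) fj≡1) χl≡1 ⟩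
    sum (λ i → χχ i j * χχ i l) + 1 + 1           ≡⟨ +-assoc (sum (λ i → χχ i j * χχ i l)) 1 1 ⟩
    sum (λ i → χχ i j * χχ i l) + 2               ∎)
    where
    open ≤-Reasoning
    χχ : Fin _ → Fin _ → ℕ
    χχ i j = 𝟙 (¬? (i Fin.≟ j)) * (χ e i * 1)
    f : Fin _ → ℕ
    f i = 𝟙 (¬? (l Fin.≟ i)) * χ e i
    χj≡1 : χ e j ≡ 1
    χj≡1 = cong 𝟙 eqj
    χl≡1 : χ e l ≡ 1
    χl≡1 = cong 𝟙 eql
    fj≡1 : f j ≡ 1
    fj≡1 = cong₂ _*_ (≢⇒𝟙 (j≢l ∘ sym)) χj≡1
    shuffle : ∀ a b c → a * (b * (c * c)) ≡ (a * (c * 1)) * (b * (c * 1))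
    shuffle = ℕ-Ring.solve-∀
    term : ∀ i → 𝟙 (¬? (j Fin.≟ i)) * f i ≡ χχ i j * χχ i l
    term i = trans (cong₂ _*_ (𝟙≢-sym j i) (cong₂ _*_ (𝟙≢-sym l i) (sym (𝟙-idem (i ∈? e)))))
                   (shuffle (𝟙 (¬? (i Fin.≟ j))) (𝟙 (¬? (i Fin.≟ l))) (χ e i))

  -- The codegree matrix of a hypergraph.

  module _ (G : Hypergraph n) where
    open Hypergraph G

    -- The matrix A. Its diagonal is set to zero because `codegree G i i` would equal the degree.
    -- Using `does` keeps the decision visible, so that the lemmas below can split on it as an
    -- argument.
    offCodegree : Fin n → Fin n → ℕ
    offCodegree i j = if does (i Fin.≟ j) then 0 else codegree G i j

    neighbourDegreeSum : Fin n → ℕ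
    neighbourDegreeSum j = ∑ₗ (filter (adjacent? G j) (allFin n)) (degree G)

    -- A splits into one complete graph per edge, which reduces its row sums and path counts to
    -- those of a single edge.
    offCodegree≡ : ∀ i j → offCodegree i j ≡ ∑ₗ edges (λ e → χχ≢ e i j)
    offCodegree≡ i j = trans (by-cases (i Fin.≟ j)) (*-distribˡ-∑ₗ (𝟙 (¬? (i Fin.≟ j))) edges (λ e → χ e i * χ e j))
      where
      by-cases : (d : Dec (i ≡ j)) → (if does d then 0 else codegree G i j) ≡ 𝟙 (¬? d) * ∑ₗ edges (λ e → χ e i * χ e j)
      by-cases (yes _) = refl
      by-cases (no _)  = trans (length-filter (λ e → (i ∈? e) ×-dec (j ∈? e)) edges)
        (trans (∑ₗ-cong edges (λ e → 𝟙-× (i ∈? e) (j ∈? e))) (sym (*-identityˡ _)))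

    offCodegree-sym : ∀ i j → offCodegree i j ≡ offCodegree j i
    offCodegree-sym i j = trans (offCodegree≡ i j) (trans
      (∑ₗ-cong edges (λ e → cong₂ _*_ (𝟙≢-sym i j) (*-comm (χ e i) (χ e j))))
      (sym (offCodegree≡ j i)))

    -- Double counting of the pairs formed by an edge through `i` and another vertex of that edge.
    sum-offCodegree : ∀ {k} → Uniform G (suc k) → ∀ i → sum (offCodegree i) ≡ k * degree G i
    sum-offCodegree {k} uniform i = begin
      sum (offCodegree i)                        ≡⟨ sum-cong-≗ (offCodegree≡ i) ⟩
      sum (λ j → ∑ₗ edges (λ e → χχ≢ e i j))     ≡⟨ sum-∑ₗ-comm edges (λ j e → χχ≢ e i j) ⟩
      ∑ₗ edges (λ e → sum (χχ≢ e i))             ≡⟨ ∑ₗ-cong-All (sum-χχ≢ i) uniform ⟩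
      ∑ₗ edges (λ e → k * χ e i)                 ≡⟨ *-distribˡ-∑ₗ k edges (λ e → χ e i) ⟨
      k * ∑ₗ edges (λ e → χ e i)                 ≡⟨ cong (k *_) (length-filter (i ∈?_) edges) ⟨
      k * degree G i                             ∎
      where open ≡-Reasoning

    -- Each common edge supplies a path through its third vertex; two-step paths that change edges
    -- only increase the right side.
    offCodegree-path : ∀ {m} → 3 ≤ m → Uniform G m → ∀ j l →
                       offCodegree j l ≤ sum (λ i → offCodegree i j * offCodegree i l)
    offCodegree-path 3≤m uniform j l = begin
      offCodegree j l                                           ≡⟨ offCodegree≡ j l ⟩
      ∑ₗ edges (λ e → χχ≢ e j l)
        ≤⟨ ∑ₗ-mono-All (λ ∣e∣≡m → χχ≢-path j l (≤-trans 3≤m (≤-reflexive (sym ∣e∣≡m)))) uniform ⟩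
      ∑ₗ edges (λ e → sum (λ i → χχ≢ e i j * χχ≢ e i l))
        ≡⟨ sum-∑ₗ-comm edges (λ i e → χχ≢ e i j * χχ≢ e i l) ⟨
      sum (λ i → ∑ₗ edges (λ e → χχ≢ e i j * χχ≢ e i l))
        ≤⟨ sum-mono (λ i → ∑ₗ-*-≤ edges (λ e → χχ≢ e i j) (λ e → χχ≢ e i l)) ⟩
      sum (λ i → ∑ₗ edges (λ e → χχ≢ e i j) * ∑ₗ edges (λ e → χχ≢ e i l))
        ≡⟨ sum-cong-≗ (λ i → cong₂ _*_ (offCodegree≡ i j) (offCodegree≡ i l)) ⟨
      sum (λ i → offCodegree i j * offCodegree i l)             ∎
      where open ≤-Reasoning

    codegree≤maxCodegree : ∀ {i j} → i ≢ j → codegree G i j ≤ maxCodegree G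
    codegree≤maxCodegree {i} {j} i≢j = All.lookup (xs≤max 0 _)
      (∈-map⁺ (λ (x , y) → codegree G x y)
        (∈-filter⁺ (λ (x , y) → ¬? (x Fin.≟ y)) (∈-cartesianProduct⁺ (∈-allFin i) (∈-allFin j)) i≢j))

    -- Distinct non-adjacent vertices share no edge. Adjacency is taken from `j` to match the filter
    -- in `neighbourDegreeSum G j`.
    offCodegree≤ : ∀ i j → offCodegree i j ≤ maxCodegree G * 𝟙 (adjacent? G j i)
    offCodegree≤ i j = by-cases (i Fin.≟ j) (adjacent? G j i)
      where
      by-cases : (i≟j : Dec (i ≡ j)) (j∼i? : Dec (Adjacent G j i)) →
                 (if does i≟j then 0 else codegree G i j) ≤ maxCodegree G * 𝟙 j∼i?
      by-cases (yes _)  _         = z≤n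
      by-cases (no i≢j) (yes _)   = ≤-trans (codegree≤maxCodegree i≢j) (≤-reflexive (sym (*-identityʳ _)))
      by-cases (no i≢j) (no ¬j∼i) = ≤-trans (≤-reflexive (cong length (List.filter-none _
        (¬Any⇒All¬ edges (λ any → ¬j∼i (i≢j ∘ sym , Any.map (λ (i∈e , j∈e) → j∈e , i∈e) any)))))) z≤n

    sum-offCodegree*degree : ∀ j → sum (λ i → offCodegree i j * degree G i) ≤ maxCodegree G ^ 2 * neighbourDegreeSum j
    sum-offCodegree*degree j = begin
      sum (λ i → offCodegree i j * degree G i)
        ≤⟨ sum-mono (λ i → *-monoˡ-≤ (degree G i) (offCodegree≤ i j)) ⟩
      sum (λ i → D * 𝟙 (adjacent? G j i) * degree G i)
        ≡⟨ sum-cong-≗ (λ i → *-assoc D (𝟙 (adjacent? G j i)) (degree G i)) ⟩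
      sum (λ i → D * (𝟙 (adjacent? G j i) * degree G i))
        ≡⟨ *-distribˡ-sum D (λ i → 𝟙 (adjacent? G j i) * degree G i) ⟨
      D * sum (λ i → 𝟙 (adjacent? G j i) * degree G i)
        ≡⟨ cong (D *_) (∑ₗ-tabulate (λ i → i) (λ i → 𝟙 (adjacent? G j i) * degree G i)) ⟨
      D * ∑ₗ (allFin n) (λ i → 𝟙 (adjacent? G j i) * degree G i)
        ≡⟨ cong (D *_) (∑ₗ-filter (adjacent? G j) (allFin n) (degree G)) ⟨
      D * neighbourDegreeSum j
        -- A natural number is at most its square; this produces the squared `maxCodegree` of the
        -- radicand.
        ≤⟨ *-monoˡ-≤ (neighbourDegreeSum j) (D≤D^2 D) ⟩
      D ^ 2 * neighbourDegreeSum j ∎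
      where
      open ≤-Reasoning
      D = maxCodegree G
      D≤D^2 : ∀ D → D ≤ D ^ 2
      D≤D^2 zero    = z≤n
      D≤D^2 (suc D) = m≤m*n (suc D) (suc D * 1)

    -- An adjacency at `j` would give an edge through `j`. This handles the case in which
    -- `averageDegree` falls back on `a / 0 = 0`.
    degree≡0⇒neighbourDegreeSum≡0 : ∀ j → degree G j ≡ 0 → neighbourDegreeSum j ≡ 0
    degree≡0⇒neighbourDegreeSum≡0 j d≡0 = cong (λ is → ∑ₗ is (degree G)) (List.filter-none (adjacent? G j)
      (All.universal (λ i (_ , any) → <⇒≢ (List.filter-some (j ∈?_) (Any.map proj₁ any)) (sym d≡0)) (allFin n)))

-- Energies of symmetric rational matrices.

module Energy where
  open import Data.Rational.Base
  open import Data.Rational.Properties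
  open import Algebra.Properties.Semiring.Sum (CommutativeRing.semiring +-*-commutativeRing) public
    using (sum; sum-cong-≗; ∑-distrib-+; ∑-comm; *-distribˡ-sum; *-distribʳ-sum; sum-replicate-zero)

  private variable n : ℕ

  sum-mono : {f g : Fin n → ℚ} → (∀ i → f i ≤ g i) → sum f ≤ sum g
  sum-mono {zero}  f≤g = ≤-refl
  sum-mono {suc n} f≤g = +-mono-≤ (f≤g zero) (sum-mono (f≤g ∘ suc))

  sum-nonNeg : {f : Fin n → ℚ} → (∀ i → 0ℚ ≤ f i) → 0ℚ ≤ sum f
  sum-nonNeg {zero}  0≤f = ≤-refl
  sum-nonNeg {suc n} 0≤f = +-mono-≤ (0≤f zero) (sum-nonNeg (0≤f ∘ suc))

  ≤-sum : {f : Fin n → ℚ} → (∀ i → 0ℚ ≤ f i) → ∀ i → f i ≤ sum f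
  ≤-sum {suc n} {f} 0≤f zero    = ≤-trans (≤-reflexive (sym (+-identityʳ (f zero)))) (+-monoʳ-≤ (f zero) (sum-nonNeg (0≤f ∘ suc)))
  ≤-sum {suc n} {f} 0≤f (suc i) = ≤-trans (≤-reflexive (sym (+-identityˡ (f (suc i))))) (+-mono-≤ (0≤f zero) (≤-sum (0≤f ∘ suc) i))

  0≤p² : ∀ p → 0ℚ ≤ p * p
  0≤p² p with ≤-total 0ℚ p
  ... | inj₁ 0≤p = 0≤* 0≤p 0≤p
  ... | inj₂ p≤0 = ≤-trans (0≤* 0≤-p 0≤-p) (≤-reflexive (solve 1 (λ p → (:- p) :* (:- p) := p :* p) refl p))
    where 0≤-p = neg-antimono-≤ p≤0

  +-cancelʳ-≤ : ∀ r {p q} → p + r ≤ q + r → p ≤ q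
  +-cancelʳ-≤ r {p} {q} h = subst₂ _≤_ (cancel p r) (cancel q r) (+-monoˡ-≤ (- r) h)
    where
    cancel : ∀ p r → p + r - r ≡ p
    cancel = solve 2 (λ p r → p :+ r :- r := p) refl

  double-cancel-≤ : ∀ {p q} → p + p ≤ q + q → p ≤ q
  double-cancel-≤ {p} {q} h = subst₂ _≤_ (half p) (half q) (*-monoˡ-≤-nonNeg ½ h)
    where
    half : ∀ p → ½ * (p + p) ≡ p
    half p = trans (*-distribˡ-+ ½ p p) (½+½ p)

  module _ (x : Fin n → ℚ) where

    _·x : (Fin n → Fin n → ℚ) → Fin n → ℚ
    (b ·x) j = sum (λ l → b j l * x l)

    -- The quadratic form of the Laplacian of the graph with weights `b`. This asymmetric form needs
    -- no factor `½`; `energy-double` recovers the squares.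
    energy : (Fin n → Fin n → ℚ) → ℚ
    energy b = sum (λ j → sum (λ l → x j * (b j l * (x j - x l))))

    -- Adding the copy with `j` and `l` exchanged completes `x j * (x j - x l)` to a square.
    energy-double : ∀ {b} → (∀ i j → b i j ≡ b j i) →
      energy b + energy b ≡ sum (λ j → sum (λ l → b j l * ((x j - x l) * (x j - x l))))
    energy-double {b} b-sym = begin
      energy b + energy b                                   ≡⟨ cong (energy b +_) (∑-comm g) ⟩
      energy b + sum (λ j → sum (λ l → g l j))              ≡⟨ ∑-distrib-+ (λ j → sum (g j)) (λ j → sum (λ l → g l j)) ⟨
      sum (λ j → sum (g j) + sum (λ l → g l j))             ≡⟨ sum-cong-≗ (λ j → sym (∑-distrib-+ (g j) (λ l → g l j))) ⟩
      sum (λ j → sum (λ l → g j l + g l j))                 ≡⟨ sum-cong-≗ (λ j → sum-cong-≗ (λ l →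
        trans (cong (λ c → g j l + x l * (c * (x l - x j))) (b-sym l j)) (square (b j l) (x j) (x l)))) ⟩
      sum (λ j → sum (λ l → b j l * ((x j - x l) * (x j - x l)))) ∎
      where
      open ≡-Reasoning
      g : Fin n → Fin n → ℚ
      g j l = x j * (b j l * (x j - x l))
      square : ∀ c p q → p * (c * (p - q)) + q * (c * (q - p)) ≡ c * ((p - q) * (p - q))
      square = solve 3 (λ c p q → p :* (c :* (p :- q)) :+ q :* (c :* (q :- p)) := c :* ((p :- q) :* (p :- q))) refl

    -- After doubling, the matrix entries are factors of squares.
    energy-mono : ∀ {b c} → (∀ i j → b i j ≡ b j i) → (∀ i j → c i j ≡ c j i) →
                  (∀ i j → b i j ≤ c i j) → energy b ≤ energy c
    energy-mono b-sym c-sym b≤c = double-cancel-≤ (subst₂ _≤_ (sym (energy-double b-sym)) (sym (energy-double c-sym))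
      (sum-mono (λ j → sum-mono (λ l → *-monoʳ-≤-nonNeg _ {{nonNegative (0≤p² (x j - x l))}} (b≤c j l)))))

    energy-split : ∀ b → energy b + sum (λ j → x j * (b ·x) j) ≡ sum (λ j → sum (b j) * (x j * x j))
    energy-split b = trans (sym (∑-distrib-+ _ (λ j → x j * (b ·x) j))) (sum-cong-≗ row)
      where
      open ≡-Reasoning
      row : ∀ j → sum (λ l → x j * (b j l * (x j - x l))) + x j * (b ·x) j ≡ sum (b j) * (x j * x j)
      row j = begin
        sum (λ l → x j * (b j l * (x j - x l))) + x j * (b ·x) j
          ≡⟨ cong (sum (λ l → x j * (b j l * (x j - x l))) +_) (*-distribˡ-sum (x j) (λ l → b j l * x l)) ⟩
        sum (λ l → x j * (b j l * (x j - x l))) + sum (λ l → x j * (b j l * x l))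
          ≡⟨ ∑-distrib-+ (λ l → x j * (b j l * (x j - x l))) (λ l → x j * (b j l * x l)) ⟨
        sum (λ l → x j * (b j l * (x j - x l)) + x j * (b j l * x l))
          ≡⟨ sum-cong-≗ (λ l → solve 3 (λ c p q → p :* (c :* (p :- q)) :+ p :* (c :* q) := c :* (p :* p)) refl (b j l) (x j) (x l)) ⟩
        sum (λ l → b j l * (x j * x j))
          ≡⟨ *-distribʳ-sum (x j * x j) (b j) ⟨
        sum (b j) * (x j * x j) ∎

    module _ (a : Fin n → Fin n → ℚ) (a-sym : ∀ i j → a i j ≡ a j i) where

      -- The square of `a`, written as its transpose times `a`: symmetry is then visible, and
      -- pairing with `x` gives a sum of squares.
      twoStep : Fin n → Fin n → ℚ
      twoStep j l = sum (λ i → a i j * a i l)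

      private
        y = a ·x

        twoStep-sym : ∀ j l → twoStep j l ≡ twoStep l j
        twoStep-sym j l = sum-cong-≗ (λ i → *-comm (a i j) (a i l))

        twoStep-rowSum : ∀ j → sum (twoStep j) ≡ sum (λ i → a i j * sum (a i))
        twoStep-rowSum j = trans (∑-comm (λ l i → a i j * a i l)) (sum-cong-≗ (λ i → sym (*-distribˡ-sum (a i j) (a i))))

        twoStep·x : ∀ j → (twoStep ·x) j ≡ sum (λ i → a i j * y i)
        twoStep·x j = begin
          sum (λ l → sum (λ i → a i j * a i l) * x l)    ≡⟨ sum-cong-≗ (λ l → *-distribʳ-sum (x l) (λ i → a i j * a i l)) ⟩
          sum (λ l → sum (λ i → a i j * a i l * x l))    ≡⟨ ∑-comm (λ l i → a i j * a i l * x l) ⟩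
          sum (λ i → sum (λ l → a i j * a i l * x l))    ≡⟨ sum-cong-≗ (λ i → trans
            (sum-cong-≗ (λ l → *-assoc (a i j) (a i l) (x l))) (sym (*-distribˡ-sum (a i j) (λ l → a i l * x l)))) ⟩
          sum (λ i → a i j * y i)                        ∎
          where open ≡-Reasoning

        ∑xtwoStep·x : sum (λ j → x j * (twoStep ·x) j) ≡ sum (λ i → y i * y i)
        ∑xtwoStep·x = begin
          sum (λ j → x j * (twoStep ·x) j)               ≡⟨ sum-cong-≗ (λ j → trans (cong (x j *_) (twoStep·x j)) (*-distribˡ-sum (x j) (λ i → a i j * y i))) ⟩
          sum (λ j → sum (λ i → x j * (a i j * y i)))    ≡⟨ ∑-comm (λ j i → x j * (a i j * y i)) ⟩
          sum (λ i → sum (λ j → x j * (a i j * y i)))    ≡⟨ sum-cong-≗ (λ i → trans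
            (sum-cong-≗ (λ j → solve 3 (λ p q r → p :* (q :* r) := q :* p :* r) refl (x j) (a i j) (y i)))
            (sym (*-distribʳ-sum (y i) (λ j → a i j * x j)))) ⟩
          sum (λ i → y i * y i)                          ∎
          where open ≡-Reasoning

      -- Monotonicity of the energy from `a` to its square, with both energies expressed by row sums
      -- and quadratic forms. The subtracted forms are moved across, so that only sums occur.
      ∑y²-bound : ∀ {k : ℚ} {d t : Fin n → ℚ} → 0ℚ ≤ k → (∀ i → sum (a i) ≡ k * d i) →
        (∀ j l → a j l ≤ twoStep j l) → (∀ j → sum (λ i → a i j * d i) ≤ t j) →
        sum (λ i → k * d i * (x i * x i) + y i * y i) ≤ sum (λ i → k * t i * (x i * x i) + x i * y i)
      ∑y²-bound {k} {d} {t} 0≤k rowSum a≤ twoStep≤ = begin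
        sum (λ i → k * d i * (x i * x i) + y i * y i)
          ≡⟨ ∑-distrib-+ (λ i → k * d i * (x i * x i)) (λ i → y i * y i) ⟩
        sum (λ i → k * d i * (x i * x i)) + Y
          ≡⟨ cong (_+ Y) (trans (sum-cong-≗ (λ i → cong (_* (x i * x i)) (sym (rowSum i)))) (sym (energy-split a))) ⟩
        energy a + Z + Y
          ≤⟨ +-monoˡ-≤ Y (+-monoˡ-≤ Z (energy-mono a-sym twoStep-sym a≤)) ⟩
        energy twoStep + Z + Y
          ≡⟨ solve 3 (λ e z y → e :+ z :+ y := (e :+ y) :+ z) refl (energy twoStep) Z Y ⟩
        energy twoStep + Y + Z
          ≡⟨ cong (_+ Z) (trans (cong (energy twoStep +_) (sym ∑xtwoStep·x)) (energy-split twoStep)) ⟩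
        sum (λ j → sum (twoStep j) * (x j * x j)) + Z
          ≤⟨ +-monoˡ-≤ Z (sum-mono (λ j → *-monoʳ-≤-nonNeg (x j * x j) {{nonNegative (0≤p² (x j))}} (row j))) ⟩
        sum (λ j → k * t j * (x j * x j)) + Z
          ≡⟨ ∑-distrib-+ (λ j → k * t j * (x j * x j)) (λ j → x j * y j) ⟨
        sum (λ i → k * t i * (x i * x i) + x i * y i) ∎
        where
        open ≤-Reasoning
        Y = sum (λ i → y i * y i)
        Z = sum (λ i → x i * y i)
        row : ∀ j → sum (twoStep j) ≤ k * t j
        row j = begin
          sum (twoStep j)                    ≡⟨ twoStep-rowSum j ⟩
          sum (λ i → a i j * sum (a i))      ≡⟨ sum-cong-≗ (λ i → trans (cong (a i j *_) (rowSum i))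
            (solve 3 (λ p q r → p :* (q :* r) := q :* (p :* r)) refl (a i j) k (d i))) ⟩
          sum (λ i → k * (a i j * d i))      ≡⟨ *-distribˡ-sum k (λ i → a i j * d i) ⟨
          k * sum (λ i → a i j * d i)        ≤⟨ *-monoˡ-≤-nonNeg k {{nonNegative 0≤k}} (twoStep≤ j) ⟩
          k * t j                            ∎

  -- The inequality at a single vertex.

  4ℚ 2ℚ : ℚ
  4ℚ = ℤ.+ 4 / 1
  2ℚ = ℤ.+ 2 / 1

  -- Here `s` approximates the root of the radicand with error `τ`. The target is
  -- `u * u + 2ℚ * k * d - rad`; the gap `δ` gives `w + g ≤ u` with `rad ≤ w * w`, so `g * g`
  -- remains.
  surplus : ∀ {k d t lam s τ δ [2k]⁻¹} → 0ℚ ≤ k → 0ℚ ≤ d → 0ℚ ≤ δ → 0ℚ ≤ s → 0ℚ ≤ τ → (2ℚ * k) * [2k]⁻¹ ≡ 1ℚ →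
    τ ≤ k * δ → 4ℚ * k * t - 2ℚ * d * k + 1ℚ ≤ (s + τ) * (s + τ) →
    (2ℚ * d * k - 1ℚ + s) * [2k]⁻¹ + δ ≤ lam →
    (k * δ) * (k * δ) ≤ 4ℚ * k * (k * ((d - lam) * (d - lam)) + lam - t)
  surplus {k} {d} {t} {lam} {s} {τ} {δ} {[2k]⁻¹} 0≤k 0≤d 0≤δ 0≤s 0≤τ inv τ≤kδ rad≤ bound+δ≤lam = +-cancelʳ-≤ rad (begin
    g * g + rad                       ≤⟨ +-monoʳ-≤ (g * g) rad≤ ⟩
    g * g + w * w                     ≡⟨ +-identityʳ (g * g + w * w) ⟨
    g * g + w * w + 0ℚ                ≤⟨ +-monoʳ-≤ (g * g + w * w) (+-mono-≤ (0≤* 0≤w 0≤g) (0≤* 0≤w 0≤g)) ⟩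
    g * g + w * w + (w * g + w * g)   ≡⟨ solve 2 (λ w g → g :* g :+ w :* w :+ (w :* g :+ w :* g) := (w :+ g) :* (w :+ g)) refl w g ⟩
    (w + g) * (w + g)                 ≤⟨ *-mono-≤₀ (≤-trans 0≤w+g w+g≤u) 0≤w+g w+g≤u w+g≤u ⟩
    u * u                             ≡⟨ +-identityʳ (u * u) ⟨
    u * u + 0ℚ                        ≤⟨ +-monoʳ-≤ (u * u) (0≤* (0≤* (nonNegative⁻¹ 2ℚ) 0≤k) 0≤d) ⟩
    u * u + 2ℚ * k * d                ≡⟨ solve 4 (λ k d t l →
      (con 2ℚ :* k :* (l :- d) :+ con 1ℚ) :* (con 2ℚ :* k :* (l :- d) :+ con 1ℚ) :+ con 2ℚ :* k :* d :=
      con 4ℚ :* k :* (k :* ((d :- l) :* (d :- l)) :+ l :- t) :+ (con 4ℚ :* k :* t :- con 2ℚ :* d :* k :+ con 1ℚ)) refl k d t lam ⟩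
    4ℚ * k * (k * ((d - lam) * (d - lam)) + lam - t) + rad ∎)
    where
    open ≤-Reasoning
    rad = 4ℚ * k * t - 2ℚ * d * k + 1ℚ
    g = k * δ
    w = s + τ
    -- lam is a root of the quadratic equation behind the bound iff u² is the radicand.
    u = 2ℚ * k * (lam - d) + 1ℚ
    0≤g : 0ℚ ≤ g
    0≤g = 0≤* 0≤k 0≤δ
    0≤w : 0ℚ ≤ w
    0≤w = +-mono-≤ 0≤s 0≤τ
    0≤w+g : 0ℚ ≤ w + g
    0≤w+g = +-mono-≤ 0≤w 0≤g
    w+g≤u : w + g ≤ u
    w+g≤u = +-cancelʳ-≤ (2ℚ * d * k - 1ℚ) (begin
      -- Multiplying by `2ℚ * k` turns the gap `δ` into `2ℚ * k * δ`: one half absorbs `τ`, the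
      -- other is `g`.
      s + τ + g + e                      ≤⟨ +-monoˡ-≤ e (+-monoˡ-≤ g (+-monoʳ-≤ s τ≤kδ)) ⟩
      s + g + g + e                      ≡⟨ solve 4 (λ s k δ e → s :+ k :* δ :+ k :* δ :+ e := (e :+ s) :* con 1ℚ :+ con 2ℚ :* k :* δ) refl s k δ e ⟩
      (e + s) * 1ℚ + 2ℚ * k * δ          ≡⟨ cong (λ z → (e + s) * z + 2ℚ * k * δ) (sym inv) ⟩
      (e + s) * (2ℚ * k * [2k]⁻¹) + 2ℚ * k * δ
        ≡⟨ solve 4 (λ p k c δ → p :* (k :* c) :+ k :* δ := k :* (p :* c :+ δ)) refl (e + s) (2ℚ * k) [2k]⁻¹ δ ⟩
      2ℚ * k * ((e + s) * [2k]⁻¹ + δ)       ≤⟨ *-monoˡ-≤-nonNeg (2ℚ * k) {{nonNegative (0≤* (nonNegative⁻¹ 2ℚ) 0≤k)}} bound+δ≤lam ⟩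
      2ℚ * k * lam                       ≡⟨ solve 3 (λ k d l → con 2ℚ :* k :* l := con 2ℚ :* k :* (l :- d) :+ con 1ℚ :+ (con 2ℚ :* d :* k :- con 1ℚ)) refl k d lam ⟩
      u + (2ℚ * d * k - 1ℚ)              ∎)
      where e = 2ℚ * d * k - 1ℚ

  -- The part linear in the residual `r` that appears when `y` is eliminated. Its grouping follows
  -- the real sequences `coefficient` and `error`, so that the terms agree by computation.
  residualTerm : (k d lam x r : ℚ) → ℚ
  residualTerm k d lam x r = 4ℚ * k * x * (2ℚ * k * d - 1ℚ + - (2ℚ * k) * lam) * r

  -- Once `y` is eliminated, the two sides differ only by the slack in `c` times `x * x` and by the
  -- square of `2ℚ * k * r`.
  vertex-estimate : ∀ {k d t lam x r c y} → y ≡ k * ((d - lam) * x - r) →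
    c ≤ 4ℚ * k * (k * ((d - lam) * (d - lam)) + lam - t) →
    c * (x * x) + 4ℚ * (k * t * (x * x) + x * y) ≤ residualTerm k d lam x r + 4ℚ * (k * d * (x * x) + y * y)
  vertex-estimate {k} {d} {t} {lam} {x} {r} {c} refl c≤q = begin
    c * (x * x) + 4ℚ * (k * t * (x * x) + x * y)
      ≤⟨ +-monoˡ-≤ (4ℚ * (k * t * (x * x) + x * y)) (*-monoʳ-≤-nonNeg (x * x) {{nonNegative (0≤p² x)}} c≤q) ⟩
    q * (x * x) + 4ℚ * (k * t * (x * x) + x * y)
      ≡⟨ +-identityʳ _ ⟨
    q * (x * x) + 4ℚ * (k * t * (x * x) + x * y) + 0ℚ
      ≤⟨ +-monoʳ-≤ (q * (x * x) + 4ℚ * (k * t * (x * x) + x * y)) (0≤p² (2ℚ * k * r)) ⟩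
    q * (x * x) + 4ℚ * (k * t * (x * x) + x * y) + (2ℚ * k * r) * (2ℚ * k * r)
      ≡⟨ solve 6 (λ k d t l x r →
        con 4ℚ :* k :* (k :* ((d :- l) :* (d :- l)) :+ l :- t) :* (x :* x) :+ con 4ℚ :* (k :* t :* (x :* x) :+ x :* (k :* ((d :- l) :* x :- r)))
          :+ (con 2ℚ :* k :* r) :* (con 2ℚ :* k :* r)
        := con 4ℚ :* k :* x :* (con 2ℚ :* k :* d :- con 1ℚ :+ :- (con 2ℚ :* k) :* l) :* r
          :+ con 4ℚ :* (k :* d :* (x :* x) :+ (k :* ((d :- l) :* x :- r)) :* (k :* ((d :- l) :* x :- r)))) refl k d t lam x r ⟩
    residualTerm k d lam x r + 4ℚ * (k * d * (x * x) + y * y) ∎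
    where
    open ≤-Reasoning
    y = k * ((d - lam) * x - r)
    q = 4ℚ * k * (k * ((d - lam) * (d - lam)) + lam - t)

  -- Adds up the vertex estimates and cancels `4ℚ * sum f`. With `∑y²-bound` comparing `g` and `f`,
  -- only the residual terms survive on the right.
  sum-≤-transfer : ∀ {p q f g : Fin n → ℚ} → (∀ i → p i + 4ℚ * f i ≤ q i + 4ℚ * g i) → sum g ≤ sum f → sum p ≤ sum q
  sum-≤-transfer {p = p} {q} {f} {g} h g≤f = +-cancelʳ-≤ (4ℚ * sum f) (begin
    sum p + 4ℚ * sum f             ≡⟨ split p f ⟩
    sum (λ i → p i + 4ℚ * f i)     ≤⟨ sum-mono h ⟩
    sum (λ i → q i + 4ℚ * g i)     ≡⟨ split q g ⟨
    sum q + 4ℚ * sum g             ≤⟨ +-monoʳ-≤ (sum q) (*-monoˡ-≤-nonNeg 4ℚ g≤f) ⟩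
    sum q + 4ℚ * sum f             ∎)
    where
    open ≤-Reasoning
    split : ∀ p f → sum p + 4ℚ * sum f ≡ sum (λ i → p i + 4ℚ * f i)
    split p f = trans (cong (sum p +_) (*-distribˡ-sum 4ℚ f)) (sym (∑-distrib-+ p (λ i → 4ℚ * f i)))

open Defs using (_≤_; _+_; _*_; _⊔_; ∑)
open Combinatorics
  using (offCodegree; neighbourDegreeSum; offCodegree-sym; sum-offCodegree; offCodegree-path;
         sum-offCodegree*degree; degree≡0⇒neighbourDegreeSum≡0)
open Energy

private variable n : ℕ

-- From natural numbers to rationals.

toℚᵘ-/ : ∀ a b → ℚ.toℚᵘ (ℤ.+ a ℚ./ suc b) ℚᵘ.≃ ℚᵘ.mkℚᵘ (ℤ.+ a) b
toℚᵘ-/ a b = ℚₚ.toℚᵘ-fromℚᵘ (ℚᵘ.mkℚᵘ (ℤ.+ a) b)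

fromℕ-+ : ∀ a b → fromℕ (a ℕ.+ b) ≡ fromℕ a ℚ.+ fromℕ b
fromℕ-+ a b = ℚₚ.toℚᵘ-injective (ℚᵘₚ.≃-trans (toℚᵘ-/ (a ℕ.+ b) 0) (ℚᵘₚ.≃-sym
  (ℚᵘₚ.≃-trans (ℚₚ.toℚᵘ-homo-+ (fromℕ a) (fromℕ b)) (ℚᵘₚ.≃-trans (ℚᵘₚ.+-cong (toℚᵘ-/ a 0) (toℚᵘ-/ b 0))
    (ℚᵘ.*≡* (cong (ℤ._* ℤ.+ 1) (cong₂ ℤ._+_ (ℤₚ.*-identityʳ (ℤ.+ a)) (ℤₚ.*-identityʳ (ℤ.+ b)))))))))

-- Reduces identities with quotients to cross-multiplication in `ℕ`.
fromℕ-*-ratio : ∀ a b c e .{{_ : NonZero b}} → c ℕ.* a ≡ e ℕ.* b → fromℕ c ℚ.* ratio a b ≡ fromℕ e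
fromℕ-*-ratio a (suc b) c e ca≡eb = ℚₚ.toℚᵘ-injective (ℚᵘₚ.≃-trans
  (ℚᵘₚ.≃-trans (ℚₚ.toℚᵘ-homo-* (fromℕ c) (ratio a (suc b))) (ℚᵘₚ.*-cong (toℚᵘ-/ c 0) (toℚᵘ-/ a b)))
  (ℚᵘₚ.≃-trans (ℚᵘ.*≡* cross) (ℚᵘₚ.≃-sym (toℚᵘ-/ e 0))))
  where
  open ≡-Reasoning
  cross : ℤ.+ c ℤ.* ℤ.+ a ℤ.* ℤ.+ 1 ≡ ℤ.+ e ℤ.* ℤ.+ suc (b ℕ.+ 0)
  cross = begin
    ℤ.+ c ℤ.* ℤ.+ a ℤ.* ℤ.+ 1      ≡⟨ ℤₚ.*-identityʳ (ℤ.+ c ℤ.* ℤ.+ a) ⟩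
    ℤ.+ c ℤ.* ℤ.+ a                ≡⟨ ℤₚ.pos-* c a ⟨
    ℤ.+ (c ℕ.* a)                  ≡⟨ cong ℤ.+_ (trans ca≡eb (cong (λ z → e ℕ.* suc z) (sym (ℕₚ.+-identityʳ b)))) ⟩
    ℤ.+ (e ℕ.* suc (b ℕ.+ 0))      ≡⟨ ℤₚ.pos-* e (suc (b ℕ.+ 0)) ⟩
    ℤ.+ e ℤ.* ℤ.+ suc (b ℕ.+ 0)    ∎

fromℕ-* : ∀ a b → fromℕ (a ℕ.* b) ≡ fromℕ a ℚ.* fromℕ b
-- `ratio b 1` is `fromℕ b` by computation.
fromℕ-* a b = sym (fromℕ-*-ratio b 1 a (a ℕ.* b) (sym (ℕₚ.*-identityʳ (a ℕ.* b))))

0≤fromℕ : ∀ a → 0ℚ ℚ.≤ fromℕ a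
0≤fromℕ a = 0≤+/ a 0

fromℕ-mono : ∀ {a b} → a ℕ.≤ b → fromℕ a ℚ.≤ fromℕ b
fromℕ-mono {a} {b} a≤b = begin
  fromℕ a                          ≡⟨ ℚₚ.+-identityʳ (fromℕ a) ⟨
  fromℕ a ℚ.+ 0ℚ                   ≤⟨ ℚₚ.+-monoʳ-≤ (fromℕ a) (0≤fromℕ (b ℕ.∸ a)) ⟩
  fromℕ a ℚ.+ fromℕ (b ℕ.∸ a)      ≡⟨ fromℕ-+ a (b ℕ.∸ a) ⟨
  fromℕ (a ℕ.+ (b ℕ.∸ a))          ≡⟨ cong fromℕ (ℕₚ.m+[n∸m]≡n a≤b) ⟩
  fromℕ b                          ∎
  where open ℚₚ.≤-Reasoning

fromℕ-sum : ∀ (f : Fin n → ℕ) → fromℕ (Combinatorics.sum f) ≡ sum (fromℕ ∘ f)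
fromℕ-sum {zero}  f = refl
fromℕ-sum {suc n} f = trans (fromℕ-+ (f zero) (Combinatorics.sum (f ∘ suc))) (cong (fromℕ (f zero) ℚ.+_) (fromℕ-sum (f ∘ suc)))

fromℕ-sum-* : ∀ (f g : Fin n → ℕ) → fromℕ (Combinatorics.sum (λ i → f i ℕ.* g i)) ≡ sum (λ i → fromℕ (f i) ℚ.* fromℕ (g i))
fromℕ-sum-* f g = trans (fromℕ-sum (λ i → f i ℕ.* g i)) (sum-cong-≗ (λ i → fromℕ-* (f i) (g i)))

sum-δ : ∀ (i : Fin n) (f : Fin n → ℚ) → sum (λ j → if does (i Fin.≟ j) then f j else 0ℚ) ≡ f i
sum-δ {suc n} zero    f = trans (cong (f zero ℚ.+_) (sum-replicate-zero n)) (ℚₚ.+-identityʳ (f zero))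
sum-δ {suc n} (suc i) f = trans (ℚₚ.+-identityˡ _) (sum-δ i (f ∘ suc))

-- Null sequences and comparison of reals.

Vanishing : ℝ → Set
Vanishing x = ∀ ε → 0ℚ ℚ.< ε → ∃[ N ] ∀ n → N ℕ.≤ n → ℚ.∣ seq x n ∣ ℚ.≤ ε

private
  ⊔≤ˡ : ∀ M {N n} → M ℕ.⊔ N ℕ.≤ n → M ℕ.≤ n
  ⊔≤ˡ M {N} = ℕₚ.m⊔n≤o⇒m≤o M N

  ⊔≤ʳ : ∀ M {N n} → M ℕ.⊔ N ℕ.≤ n → N ℕ.≤ n
  ⊔≤ʳ M {N} = ℕₚ.m⊔n≤o⇒n≤o M N

vanishing⇒≃0 : ∀ x → Vanishing x → x ≃ 0ℝ
vanishing⇒≃0 x x→0 ε 0<ε = let N , h = x→0 ε 0<ε in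
  N , λ n N≤n → subst (ℚ._≤ ε) (cong ℚ.∣_∣ (sym (ℚₚ.+-identityʳ (seq x n)))) (h n N≤n)

≃⇒vanishing : ∀ x y → x ≃ y → Vanishing (x + fromℚ (ℚ.- 1ℚ) * y)
≃⇒vanishing x y x≃y ε 0<ε = let N , h = x≃y ε 0<ε in
  N , λ n N≤n → subst (ℚ._≤ ε) (cong ℚ.∣_∣ (solve 2 (λ p q → p :- q := p :+ con (ℚ.- 1ℚ) :* q) refl (seq x n) (seq y n))) (h n N≤n)

vanishing-* : ∀ x y → Vanishing y → Vanishing (x * y)
vanishing-* x y y→0 ε 0<ε =
  let B , 0<B , M , ∣x∣≤B = eventuallyBounded x
      instance B-pos = ℚ.positive 0<B
               B-nonZero = ℚₚ.pos⇒nonZero B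
      N , ∣y∣≤ = y→0 (ℚ.1/ B ℚ.* ε) (0<* (ℚₚ.positive⁻¹ (ℚ.1/ B) {{ℚₚ.1/pos⇒pos B}}) 0<ε)
  in M ℕ.⊔ N , λ n M⊔N≤n → begin
    ℚ.∣ seq x n ℚ.* seq y n ∣             ≡⟨ ℚₚ.∣p*q∣≡∣p∣*∣q∣ (seq x n) (seq y n) ⟩
    ℚ.∣ seq x n ∣ ℚ.* ℚ.∣ seq y n ∣       ≤⟨ *-mono-≤₀ (ℚₚ.<⇒≤ 0<B) (ℚₚ.0≤∣p∣ (seq y n)) (∣x∣≤B n (⊔≤ˡ M M⊔N≤n)) (∣y∣≤ n (⊔≤ʳ M M⊔N≤n)) ⟩
    B ℚ.* (ℚ.1/ B ℚ.* ε)                  ≡⟨ ℚₚ.*-assoc B (ℚ.1/ B) ε ⟨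
    B ℚ.* ℚ.1/ B ℚ.* ε                    ≡⟨ cong (ℚ._* ε) (ℚₚ.*-inverseʳ B) ⟩
    1ℚ ℚ.* ε                              ≡⟨ ℚₚ.*-identityˡ ε ⟩
    ε                                     ∎
  where open ℚₚ.≤-Reasoning

vanishing-∑ : ∀ (f : Fin n → ℝ) → (∀ i → Vanishing (f i)) → Vanishing (∑ f)
vanishing-∑ {zero}  f f→0 ε 0<ε = 0 , λ _ _ → ℚₚ.<⇒≤ 0<ε
vanishing-∑ {suc n} f f→0 ε 0<ε =
  let M , h₀ = f→0 zero (½ ℚ.* ε) (0<½* 0<ε)
      N , h  = vanishing-∑ (f ∘ suc) (f→0 ∘ suc) (½ ℚ.* ε) (0<½* 0<ε)
  in M ℕ.⊔ N , λ n M⊔N≤n → ℚₚ.≤-trans (ℚₚ.∣p+q∣≤∣p∣+∣q∣ (seq (f zero) n) (seq (∑ (f ∘ suc)) n))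
       (ℚₚ.≤-trans (ℚₚ.+-mono-≤ (h₀ n (⊔≤ˡ M M⊔N≤n)) (h n (⊔≤ʳ M M⊔N≤n))) (ℚₚ.≤-reflexive (½+½ ε)))

∣p∣²≡p² : ∀ p → ℚ.∣ p ∣ ℚ.* ℚ.∣ p ∣ ≡ p ℚ.* p
∣p∣²≡p² p = trans (sym (ℚₚ.∣p*q∣≡∣p∣*∣q∣ p p)) (ℚₚ.0≤p⇒∣p∣≡p (0≤p² p))

-- Cancelling `c` and comparing squares turns the tolerance `c * (ε * ε)` for `e` into the tolerance
-- `ε` for `x`.
vanishing-square : ∀ {c} x e → 0ℚ ℚ.< c → Vanishing e →
  ∃[ N ] (∀ n → N ℕ.≤ n → c ℚ.* (seq x n ℚ.* seq x n) ℚ.≤ seq e n) → Vanishing x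
vanishing-square {c} x e 0<c e→0 (M , cx²≤e) ε 0<ε =
  let N , ∣e∣≤ = e→0 (c ℚ.* (ε ℚ.* ε)) (0<* 0<c (0<* 0<ε 0<ε))
  in M ℕ.⊔ N , λ n M⊔N≤n → sq-cancel-≤ (ℚₚ.<⇒≤ 0<ε) (ℚₚ.*-cancelˡ-≤-pos c {{ℚ.positive 0<c}} (begin
    c ℚ.* (ℚ.∣ seq x n ∣ ℚ.* ℚ.∣ seq x n ∣)   ≡⟨ cong (c ℚ.*_) (∣p∣²≡p² (seq x n)) ⟩
    c ℚ.* (seq x n ℚ.* seq x n)               ≤⟨ cx²≤e n (⊔≤ˡ M M⊔N≤n) ⟩
    seq e n                                   ≤⟨ p≤∣p∣ (seq e n) ⟩
    ℚ.∣ seq e n ∣                             ≤⟨ ∣e∣≤ n (⊔≤ʳ M M⊔N≤n) ⟩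
    c ℚ.* (ε ℚ.* ε)                           ∎))
  where open ℚₚ.≤-Reasoning

-- Cauchy sequences are compared by looking at a single sufficiently late index.
separate : ∀ x y {η} → 0ℚ ℚ.< η →
  (∃[ N ] ∀ n → N ℕ.≤ n → seq y n ℚ.+ η ℚ.≤ seq x n) ⊎
  (∃[ N ] ∀ n → N ℕ.≤ n → seq x n ℚ.≤ seq y n ℚ.+ (η ℚ.+ η ℚ.+ η ℚ.+ η ℚ.+ η))
separate x y {η} 0<η with cauchy x η 0<η | cauchy y η 0<η
-- Past `K` each sequence moves by at most `η`, so a comparison with margin `3η` at `K` leaves a gap
-- of `3η - 2η` or an excess of `3η + 2η`.
... | M , hM | N , hN = by-cases (seq x K ℚₚ.≤? seq y K ℚ.+ (η ℚ.+ η ℚ.+ η))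
  where
  open ℚₚ.≤-Reasoning
  K = M ℕ.⊔ N
  x-near : ∀ {m n} → K ℕ.≤ m → K ℕ.≤ n → seq x m ℚ.≤ seq x n ℚ.+ η
  x-near {m} {n} K≤m K≤n = ∣-∣≤⇒≤+ (seq x m) (seq x n) (hM m n (⊔≤ˡ M K≤m) (⊔≤ˡ M K≤n))
  y-near : ∀ {m n} → K ℕ.≤ m → K ℕ.≤ n → seq y m ℚ.≤ seq y n ℚ.+ η
  y-near {m} {n} K≤m K≤n = ∣-∣≤⇒≤+ (seq y m) (seq y n) (hN m n (⊔≤ʳ M K≤m) (⊔≤ʳ M K≤n))
  by-cases : Dec (seq x K ℚ.≤ seq y K ℚ.+ (η ℚ.+ η ℚ.+ η)) → _
  by-cases (yes x≤y+3η) = inj₂ (K , λ n K≤n → begin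
    seq x n                                      ≤⟨ x-near K≤n ℕₚ.≤-refl ⟩
    seq x K ℚ.+ η                                ≤⟨ ℚₚ.+-monoˡ-≤ η x≤y+3η ⟩
    seq y K ℚ.+ (η ℚ.+ η ℚ.+ η) ℚ.+ η            ≤⟨ ℚₚ.+-monoˡ-≤ η (ℚₚ.+-monoˡ-≤ (η ℚ.+ η ℚ.+ η) (y-near ℕₚ.≤-refl K≤n)) ⟩
    seq y n ℚ.+ η ℚ.+ (η ℚ.+ η ℚ.+ η) ℚ.+ η      ≡⟨ solve 2 (λ p h → p :+ h :+ (h :+ h :+ h) :+ h := p :+ (h :+ h :+ h :+ h :+ h)) refl (seq y n) η ⟩
    seq y n ℚ.+ (η ℚ.+ η ℚ.+ η ℚ.+ η ℚ.+ η)      ∎)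
  by-cases (no x≰y+3η) = inj₁ (K , λ n K≤n → +-cancelʳ-≤ (η ℚ.+ η) (begin
    seq y n ℚ.+ η ℚ.+ (η ℚ.+ η)                  ≤⟨ ℚₚ.+-monoˡ-≤ (η ℚ.+ η) (ℚₚ.+-monoˡ-≤ η (y-near K≤n ℕₚ.≤-refl)) ⟩
    seq y K ℚ.+ η ℚ.+ η ℚ.+ (η ℚ.+ η)            ≡⟨ solve 2 (λ p h → p :+ h :+ h :+ (h :+ h) := p :+ (h :+ h :+ h) :+ h) refl (seq y K) η ⟩
    seq y K ℚ.+ (η ℚ.+ η ℚ.+ η) ℚ.+ η            ≤⟨ ℚₚ.+-monoˡ-≤ η (ℚₚ.<⇒≤ (ℚₚ.≰⇒> x≰y+3η)) ⟩
    seq x K ℚ.+ η                                ≤⟨ ℚₚ.+-monoˡ-≤ η (x-near ℕₚ.≤-refl K≤n) ⟩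
    seq x n ℚ.+ η ℚ.+ η                          ≡⟨ ℚₚ.+-assoc (seq x n) η η ⟩
    seq x n ℚ.+ (η ℚ.+ η)                        ∎))

-- The order need not be decided exactly: `separate` yields either an eventual gap, which is
-- refuted, or an upper bound with error `5η`. The choice `η = ε / 5` makes that error `ε`.
≤-by-contradiction : ∀ x y →
  (∀ δ → 0ℚ ℚ.< δ → ∃[ N ] (∀ n → N ℕ.≤ n → seq y n ℚ.+ δ ℚ.≤ seq x n) → ⊥) → x ≤ y
≤-by-contradiction x y refute ε 0<ε with separate x y 0<η
  where
  0<η : 0ℚ ℚ.< ℤ.+ 1 ℚ./ 5 ℚ.* ε
  0<η = 0<* (ℚₚ.positive⁻¹ (ℤ.+ 1 ℚ./ 5)) 0<ε
... | inj₁ y+η≤x        = ⊥-elim (refute _ (0<* (ℚₚ.positive⁻¹ (ℤ.+ 1 ℚ./ 5)) 0<ε) y+η≤x)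
... | inj₂ (N , x≤y+5η) = N , λ n N≤n → ℚₚ.≤-trans (x≤y+5η n N≤n)
  (ℚₚ.≤-reflexive (cong (seq y n ℚ.+_) (solve 1 (λ ε → let h = con (ℤ.+ 1 ℚ./ 5) :* ε in h :+ h :+ h :+ h :+ h := ε) refl ε)))

seq-∑ : ∀ (f : Fin n → ℝ) t → seq (∑ f) t ≡ sum (λ i → seq (f i) t)
seq-∑ {zero}  f t = refl
seq-∑ {suc n} f t = cong (seq (f zero) t ℚ.+_) (seq-∑ (f ∘ suc) t)

private
  seq-foldr-⊔ : ∀ z (f : Fin n → ℝ) t → (seq z t ℚ.≤ seq (foldr _⊔_ z f) t) × (∀ i → seq (f i) t ℚ.≤ seq (foldr _⊔_ z f) t)
  seq-foldr-⊔ {zero}  z f t = ℚₚ.≤-refl , λ ()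
  seq-foldr-⊔ {suc n} z f t = let z≤ , f≤ = seq-foldr-⊔ z (f ∘ suc) t in
    ℚₚ.≤-trans z≤ (ℚₚ.p≤q⊔p (seq (f zero) t) _) ,
    λ { zero    → ℚₚ.p≤p⊔q (seq (f zero) t) _
      ; (suc i) → ℚₚ.≤-trans (f≤ i) (ℚₚ.p≤q⊔p (seq (f zero) t) _) }

seq-≤-maximum : ∀ .{{_ : NonZero n}} (f : Fin n → ℝ) t i → seq (f i) t ℚ.≤ seq (maximum f) t
seq-≤-maximum {suc n} f t zero    = proj₁ (seq-foldr-⊔ (f zero) (f ∘ suc) t)
seq-≤-maximum {suc n} f t (suc i) = proj₂ (seq-foldr-⊔ (f zero) (f ∘ suc) t) i

-- The Laplacian and the degree bound, with `K` for m - 1.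

module _ (G : Hypergraph n) (K : ℕ) .{{_ : NonZero K}} where
  private
    k = fromℕ K
    a : Fin n → Fin n → ℚ
    a i j = fromℕ (offCodegree G i j)
    d : Fin n → ℚ
    d i = fromℕ (degree G i)
    T : Fin n → ℚ
    T i = fromℕ (maxCodegree G ^ 2 ℕ.* neighbourDegreeSum G i)

  -- The factor `k` cancels the denominator m - 1 off the diagonal, which leaves `k` times the
  -- diagonal degree matrix.
  laplacian-entry : ∀ i j s → k ℚ.* seq (laplacian G (suc K) i j) s ℚ.+ a i j ≡ (if does (i Fin.≟ j) then k ℚ.* d i else 0ℚ)
  laplacian-entry i j s with i Fin.≟ j
  ... | yes _ = ℚₚ.+-identityʳ (k ℚ.* d i)
  ... | no _  = begin
    k ℚ.* (ℚ.- ratio c K) ℚ.+ fromℕ c    ≡⟨ cong (k ℚ.* (ℚ.- ratio c K) ℚ.+_) (fromℕ-*-ratio c K K c (ℕₚ.*-comm K c)) ⟨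
    k ℚ.* (ℚ.- ratio c K) ℚ.+ k ℚ.* ratio c K  ≡⟨ solve 2 (λ k r → k :* (:- r) :+ k :* r := con 0ℚ) refl k (ratio c K) ⟩
    0ℚ                                   ∎
    where
    open ≡-Reasoning
    c = codegree G i j

  laplacian-apply : ∀ (x : Fin n → ℚ) i s →
    k ℚ.* sum (λ j → seq (laplacian G (suc K) i j) s ℚ.* x j) ℚ.+ sum (λ j → a i j ℚ.* x j) ≡ k ℚ.* d i ℚ.* x i
  laplacian-apply x i s = begin
    k ℚ.* sum (λ j → L j ℚ.* x j) ℚ.+ sum (λ j → a i j ℚ.* x j)
      ≡⟨ cong (ℚ._+ _) (*-distribˡ-sum k (λ j → L j ℚ.* x j)) ⟩
    sum (λ j → k ℚ.* (L j ℚ.* x j)) ℚ.+ sum (λ j → a i j ℚ.* x j)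
      ≡⟨ ∑-distrib-+ (λ j → k ℚ.* (L j ℚ.* x j)) (λ j → a i j ℚ.* x j) ⟨
    sum (λ j → k ℚ.* (L j ℚ.* x j) ℚ.+ a i j ℚ.* x j)
      ≡⟨ sum-cong-≗ (λ j → trans (solve 4 (λ k l a x → k :* (l :* x) :+ a :* x := (k :* l :+ a) :* x) refl k (L j) (a i j) (x j))
           (trans (cong (ℚ._* x j) (laplacian-entry i j s)) (if-* (does (i Fin.≟ j)) (x j)))) ⟩
    sum (λ j → if does (i Fin.≟ j) then k ℚ.* d i ℚ.* x j else 0ℚ)
      ≡⟨ sum-δ i (λ j → k ℚ.* d i ℚ.* x j) ⟩
    k ℚ.* d i ℚ.* x i ∎
    where
    open ≡-Reasoning
    L : Fin n → ℚ
    L j = seq (laplacian G (suc K) i j) s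
    if-* : ∀ b z → (if b then k ℚ.* d i else 0ℚ) ℚ.* z ≡ (if b then k ℚ.* d i ℚ.* z else 0ℚ)
    if-* true  z = refl
    if-* false z = ℚₚ.*-zeroˡ z

  fromℕ-2dK : ∀ i → fromℕ (2 ℕ.* degree G i ℕ.* K) ≡ 2ℚ ℚ.* d i ℚ.* k
  fromℕ-2dK i = trans (fromℕ-* (2 ℕ.* degree G i) K) (cong (ℚ._* k) (fromℕ-* 2 (degree G i)))

  -- The degree and one factor `K` cancel against the denominator of `averageDegree`.
  radicand≡ : ∀ i → radicand G (suc K) i ≡ 4ℚ ℚ.* k ℚ.* T i ℚ.- 2ℚ ℚ.* d i ℚ.* k ℚ.+ 1ℚ
  radicand≡ i = cong₂ (λ p q → p ℚ.- q ℚ.+ 1ℚ) (trans (cong (ℚ._* fromℕ (D ^ 2)) (clear (degree G i) refl)) collect) (fromℕ-2dK i)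
    where
    D = maxCodegree G
    S = neighbourDegreeSum G i
    -- The degree is generalised to a variable so that `ratio` computes. At zero it takes its
    -- default `0ℚ`, and the neighbour degrees then sum to zero as well.
    clear : ∀ δ → degree G i ≡ δ → fromℕ (4 ℕ.* K ^ 2 ℕ.* δ) ℚ.* ratio S (δ ℕ.* K) ≡ fromℕ (4 ℕ.* K ℕ.* S)
    clear zero    deg≡0 = trans (ℚₚ.*-zeroʳ (fromℕ (4 ℕ.* K ^ 2 ℕ.* 0)))
      (cong fromℕ (sym (trans (cong (4 ℕ.* K ℕ.*_) (degree≡0⇒neighbourDegreeSum≡0 G i deg≡0)) (ℕₚ.*-zeroʳ (4 ℕ.* K)))))
    clear (suc δ) _     = fromℕ-*-ratio S (suc δ ℕ.* K) (4 ℕ.* K ^ 2 ℕ.* suc δ) (4 ℕ.* K ℕ.* S) {{ℕₚ.m*n≢0 (suc δ) K}} (shuffle K (suc δ) S)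
      where
      shuffle : ∀ K δ S → 4 ℕ.* (K ℕ.* (K ℕ.* 1)) ℕ.* δ ℕ.* S ≡ 4 ℕ.* K ℕ.* S ℕ.* (δ ℕ.* K)
      shuffle = ℕ-Ring.solve-∀
    collect : fromℕ (4 ℕ.* K ℕ.* S) ℚ.* fromℕ (D ^ 2) ≡ 4ℚ ℚ.* k ℚ.* T i
    collect = begin
      fromℕ (4 ℕ.* K ℕ.* S) ℚ.* fromℕ (D ^ 2)    ≡⟨ fromℕ-* (4 ℕ.* K ℕ.* S) (D ^ 2) ⟨
      fromℕ (4 ℕ.* K ℕ.* S ℕ.* D ^ 2)            ≡⟨ cong fromℕ (trans (ℕₚ.*-assoc (4 ℕ.* K) S (D ^ 2)) (cong (4 ℕ.* K ℕ.*_) (ℕₚ.*-comm S (D ^ 2)))) ⟩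
      fromℕ (4 ℕ.* K ℕ.* (D ^ 2 ℕ.* S))          ≡⟨ fromℕ-* (4 ℕ.* K) (D ^ 2 ℕ.* S) ⟩
      fromℕ (4 ℕ.* K) ℚ.* T i                    ≡⟨ cong (ℚ._* T i) (fromℕ-* 4 K) ⟩
      4ℚ ℚ.* k ℚ.* T i                           ∎
      where open ≡-Reasoning

  -- Applies `surplus` to the approximate root at index `s`, with `1/suc s` as its error `τ`.
  degreeBound-surplus : ∀ i s {lam δ} → 0ℚ ℚ.≤ δ → 1/suc s ℚ.≤ k ℚ.* δ →
    seq (degreeBound G (suc K) i) s ℚ.+ δ ℚ.≤ lam →
    (k ℚ.* δ) ℚ.* (k ℚ.* δ) ℚ.≤ 4ℚ ℚ.* k ℚ.* (k ℚ.* ((d i ℚ.- lam) ℚ.* (d i ℚ.- lam)) ℚ.+ lam ℚ.- T i)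
  degreeBound-surplus i s {lam} {δ} 0≤δ τ≤kδ bound+δ≤lam = surplus {[2k]⁻¹ = ratio 1 (2 ℕ.* K)}
    (0≤fromℕ K) (0≤fromℕ (degree G i)) 0≤δ (sqrtApprox-nonNeg s (radicand G (suc K) i)) (0≤+/ 1 s)
    (trans (cong (ℚ._* ratio 1 (2 ℕ.* K)) (sym (fromℕ-* 2 K))) (fromℕ-*-ratio 1 (2 ℕ.* K) (2 ℕ.* K) 1 {{ℕₚ.m*n≢0 2 K}} (ℕₚ.*-comm (2 ℕ.* K) 1)))
    τ≤kδ
    (subst (ℚ._≤ (sqrtApprox s (radicand G (suc K) i) ℚ.+ 1/suc s) ℚ.* (sqrtApprox s (radicand G (suc K) i) ℚ.+ 1/suc s)) (radicand≡ i) (sqrtApprox-≥ s (radicand G (suc K) i)))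
    (subst (λ z → (z ℚ.- 1ℚ ℚ.+ sqrtApprox s (radicand G (suc K) i)) ℚ.* ratio 1 (2 ℕ.* K) ℚ.+ δ ℚ.≤ lam) (fromℕ-2dK i) bound+δ≤lam)

  -- `x` and `lam` are arbitrary rationals, and `r` measures how far they are from solving the
  -- eigenvalue equation; each term on the right is proportional to `r`.
  eigenvector-estimate : 2 ℕ.≤ K → Uniform G (suc K) → ∀ (x : Fin n → ℚ) lam s c →
    let r = λ i → sum (λ j → seq (laplacian G (suc K) i j) s ℚ.* x j) ℚ.+ (ℚ.- 1ℚ) ℚ.* (lam ℚ.* x i) in
    (∀ i → c ℚ.≤ 4ℚ ℚ.* k ℚ.* (k ℚ.* ((d i ℚ.- lam) ℚ.* (d i ℚ.- lam)) ℚ.+ lam ℚ.- T i)) →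
    sum (λ i → c ℚ.* (x i ℚ.* x i)) ℚ.≤ sum (λ i → residualTerm k (d i) lam (x i) (r i))
  eigenvector-estimate 2≤K uniform x lam s c c≤ =
    sum-≤-transfer (λ i → vertex-estimate {k} {d i} {T i} {lam} {x i} (y≡ i) (c≤ i))
      (∑y²-bound x a (λ i j → cong fromℕ (offCodegree-sym G i j)) {k} {d} {T} (0≤fromℕ K)
        (λ i → trans (sym (fromℕ-sum (offCodegree G i))) (trans (cong fromℕ (sum-offCodegree G uniform i)) (fromℕ-* K (degree G i))))
        (λ j l → subst (a j l ℚ.≤_) (fromℕ-sum-* (λ i → offCodegree G i j) (λ i → offCodegree G i l))
          -- `s≤s 2≤K` says that edges have at least three vertices: here `m > 2` provides the third
          -- vertex.
          (fromℕ-mono (offCodegree-path G (s≤s 2≤K) uniform j l)))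
        (λ j → subst (ℚ._≤ T j) (fromℕ-sum-* (λ i → offCodegree G i j) (degree G)) (fromℕ-mono (sum-offCodegree*degree G j))))
    where
    -- Combines `k L x + A x = k d x` with `L x = lam x + r`.
    y≡ : ∀ i → sum (λ j → a i j ℚ.* x j) ≡ k ℚ.* ((d i ℚ.- lam) ℚ.* x i ℚ.- (sum (λ j → seq (laplacian G (suc K) i j) s ℚ.* x j) ℚ.+ (ℚ.- 1ℚ) ℚ.* (lam ℚ.* x i)))
    y≡ i = begin
      y                                    ≡⟨ solve 2 (λ y z → y := z :+ y :- z) refl y (k ℚ.* Lx) ⟩
      k ℚ.* Lx ℚ.+ y ℚ.- k ℚ.* Lx          ≡⟨ cong (ℚ._- k ℚ.* Lx) (laplacian-apply x i s) ⟩
      k ℚ.* d i ℚ.* x i ℚ.- k ℚ.* Lx       ≡⟨ solve 5 (λ k d x z l → k :* d :* x :- k :* z := k :* ((d :- l) :* x :- (z :+ con (ℚ.- 1ℚ) :* (l :* x)))) refl k (d i) (x i) Lx lam ⟩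
      k ℚ.* ((d i ℚ.- lam) ℚ.* x i ℚ.- (Lx ℚ.+ (ℚ.- 1ℚ) ℚ.* (lam ℚ.* x i))) ∎
      where
      open ≡-Reasoning
      y = sum (λ j → a i j ℚ.* x j)
      Lx = sum (λ j → seq (laplacian G (suc K) i j) s ℚ.* x j)

-- The contradiction from a uniform gap.

theorem12 : (n m : ℕ) .{{_ : NonZero n}} (G : Hypergraph n) →
    2 < m → Uniform G m → Connected G →
    (λₙ : ℝ) → IsLargestEigenvalue (laplacian G m) λₙ →
    λₙ ≤ maximum (degreeBound G m)
theorem12 n (suc K@(suc _)) G (s≤s 2≤K) uniform _ λₙ ((v , v≄0 , Lv≃λv) , _) =
  ≤-by-contradiction λₙ (maximum (degreeBound G (suc K))) λ δ 0<δ (N , bound+δ≤λ) →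
    -- The product of `K` and `δ` serves twice: as tolerance for the approximate square roots and,
    -- squared, as the constant `c` common to all vertices.
    let 0<kδ         = 0<* (ℚₚ.positive⁻¹ (fromℕ K) {{ℚₚ.normalize-pos K 1}}) 0<δ
        M , 1/suc≤kδ = 1/suc-archimedean (fromℕ K ℚ.* δ) 0<kδ
    -- A fixed positive multiple of each squared coordinate is eventually at most `∑ error`, which
    -- tends to zero; every coordinate then vanishes, against `v≄0`.
    in v≄0 λ i → vanishing⇒≃0 (v i) (vanishing-square (v i) (∑ error) (0<* 0<kδ 0<kδ) error→0
         (M ℕ.⊔ N , λ s M⊔N≤s → estimate s i (ℚₚ.<⇒≤ 0<δ) (1/suc≤kδ s (⊔≤ˡ M M⊔N≤s)) (bound+δ≤λ s (⊔≤ʳ M M⊔N≤s))))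
  where
  -- At each index `error` gives the residual terms of the rational estimate, up to `seq-∑`. As
  -- products with a vanishing factor they tend to zero.
  residual coefficient error : Fin n → ℝ
  residual i = ∑ (λ j → laplacian G (suc K) i j * v j) + fromℚ (ℚ.- 1ℚ) * (λₙ * v i)
  coefficient i = fromℚ (4ℚ ℚ.* fromℕ K) * v i
    * (fromℚ (2ℚ ℚ.* fromℕ K ℚ.* fromℕ (degree G i) ℚ.- 1ℚ) + fromℚ (ℚ.- (2ℚ ℚ.* fromℕ K)) * λₙ)
  error i = coefficient i * residual i

  error→0 : Vanishing (∑ error)
  error→0 = vanishing-∑ error (λ i → vanishing-* (coefficient i) (residual i)
    (≃⇒vanishing (∑ (λ j → laplacian G (suc K) i j * v j)) (λₙ * v i) (Lv≃λv i)))

  estimate : ∀ s i {δ} → 0ℚ ℚ.≤ δ → 1/suc s ℚ.≤ fromℕ K ℚ.* δ →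
    seq (maximum (degreeBound G (suc K))) s ℚ.+ δ ℚ.≤ seq λₙ s →
    (fromℕ K ℚ.* δ) ℚ.* (fromℕ K ℚ.* δ) ℚ.* (seq (v i) s ℚ.* seq (v i) s) ℚ.≤ seq (∑ error) s
  estimate s i {δ} 0≤δ 1/suc≤kδ max+δ≤λ = begin
    -- All terms are nonnegative, so a single vertex is bounded by the total, to which the energy
    -- argument applies.
    c ℚ.* (x i ℚ.* x i)                    ≤⟨ ≤-sum (λ i → 0≤* (0≤p² (fromℕ K ℚ.* δ)) (0≤p² (x i))) i ⟩
    sum (λ i → c ℚ.* (x i ℚ.* x i))        ≤⟨ eigenvector-estimate G K 2≤K uniform x (seq λₙ s) s c (λ i →
      degreeBound-surplus G K i s 0≤δ 1/suc≤kδ (ℚₚ.≤-trans (ℚₚ.+-monoˡ-≤ δ (seq-≤-maximum (degreeBound G (suc K)) s i)) max+δ≤λ)) ⟩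
    sum (λ i → residualTerm (fromℕ K) (fromℕ (degree G i)) (seq λₙ s) (x i)
                 (sum (λ j → seq (laplacian G (suc K) i j) s ℚ.* x j) ℚ.+ (ℚ.- 1ℚ) ℚ.* (seq λₙ s ℚ.* x i)))
      ≡⟨ sum-cong-≗ (λ i → cong (λ z → residualTerm (fromℕ K) (fromℕ (degree G i)) (seq λₙ s) (x i) (z ℚ.+ (ℚ.- 1ℚ) ℚ.* (seq λₙ s ℚ.* x i)))
           (sym (seq-∑ (λ j → laplacian G (suc K) i j * v j) s))) ⟩
    sum (λ i → seq (error i) s)            ≡⟨ seq-∑ error s ⟨
    seq (∑ error) s                        ∎
    where
    open ℚₚ.≤-Reasoning
    x : Fin n → ℚ
    x i = seq (v i) s
    c = (fromℕ K ℚ.* δ) ℚ.* (fromℕ K ℚ.* δ)
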